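{- Let $f(X)=a_nX^n+\cdots+a_1X+a_0$ be a polynomial with real coefficients, with $n\ge 1$ and $a_n>0$, and denote by $j_1<j_2<\cdots<j_\ell$ the indices $j$ for which $a_j<0$. Let $$v=\max_{1\le i\le \ell}\left(\frac{|a_{j_1}+a_{j_2}+\cdots+a_{j_\ell}|}{a_n}\right)^{\frac{1}{n-j_i}}.$$ Then $f$ has no zero in the sector $S_{v,\frac{\pi}{n}}$.
   Context: For real numbers $v,\theta$ with $0<\theta\le\pi$, define the open sector $S_{v,\theta}=\{z=v+\rho e^{i\varphi}\in\mathbb{C}:\rho>0,\ |\varphi|<\theta\}$ (with $\varphi$ real). If $f$ has no negative coefficients ($\ell=0$), the maximum over the empty set is understood to be $0$, i.e. $v=0$. -}

module Defs where

open import Algebra.Bundles using (CommutativeRing; RawRing)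
open import Algebra.Core using (Op₁; Op₂)
import Algebra.Definitions.RawSemiring as RawSemiringDefs
import Algebra.Construct.NaturalChoice.Max as Max
open import Data.Fin.Base using (Fin; toℕ)
open import Data.List.Base using (List; allFin; filter; foldr; map)
import Data.List.Extrema as Extrema
open import Data.Nat.Base as ℕ using (ℕ; suc; _!)
open import Data.Product.Base using (_×_; _,_; ∃; ∃-syntax; proj₁; proj₂)
open import Data.Vec.Functional using (Vector)
open import Level using (Level; _⊔_) renaming (suc to lsuc)
open import Relation.Binary.Bundles using (StrictTotalOrder; TotalOrder; DecTotalOrder)
open import Relation.Binary.Core using (Rel)
open import Relation.Binary.Structures using (IsStrictTotalOrder)
import Relation.Binary.Properties.StrictTotalOrder as StrictTotalOrderProps
open import Relation.Nullary.Negation using (¬_)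

-- The real numbers, characterised (uniquely up to isomorphism, in classical
-- mathematics) as the Dedekind-complete ordered field.
record CompleteOrderedField c ℓ₁ ℓ₂ : Set (lsuc (c ⊔ ℓ₁ ⊔ ℓ₂)) where
  infix 4 _<_
  infix 8 _⁻¹
  infixl 7 _/_
  field
    commutativeRing : CommutativeRing c ℓ₁

  open CommutativeRing commutativeRing public

  field
    _<_                : Rel Carrier ℓ₂
    isStrictTotalOrder : IsStrictTotalOrder _≈_ _<_
    0≉1                : ¬ (0# ≈ 1#)
    -- The value of 0# ⁻¹ is unspecified.
    _⁻¹                : Op₁ Carrier
    *-inverseʳ         : ∀ x → ¬ (x ≈ 0#) → x * x ⁻¹ ≈ 1#
    +-monoˡ-<          : ∀ z {x y} → x < y → x + z < y + z
    *-pos              : ∀ {x y} → 0# < x → 0# < y → 0# < x * y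

  strictTotalOrder : StrictTotalOrder c ℓ₁ ℓ₂
  strictTotalOrder = record { isStrictTotalOrder = isStrictTotalOrder }

  open StrictTotalOrder strictTotalOrder public using (compare; _<?_)

  totalOrder : TotalOrder c ℓ₁ (ℓ₁ ⊔ ℓ₂)
  totalOrder = DecTotalOrder.totalOrder
    (StrictTotalOrderProps.decTotalOrder strictTotalOrder)

  -- x ≤ y is x < y or x ≈ y.
  open TotalOrder totalOrder public using (_≤_)

  _/_ : Op₂ Carrier
  x / y = x * y ⁻¹

  UpperBound : ∀ {p} → (Carrier → Set p) → Carrier → Set (c ⊔ ℓ₁ ⊔ ℓ₂ ⊔ p)
  UpperBound P b = ∀ x → P x → x ≤ b

  -- Leastness in its ε-form: nothing below s is an upper bound, as witnessed
  -- by an element of P.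
  IsSupremum : ∀ {p} → (Carrier → Set p) → Carrier → Set (c ⊔ ℓ₁ ⊔ ℓ₂ ⊔ p)
  IsSupremum P s = UpperBound P s × (∀ x → x < s → ∃[ y ] P y × x < y)

  field
    complete : (P : Carrier → Set (c ⊔ ℓ₁ ⊔ ℓ₂)) →
               ∃ P → ∃ (UpperBound P) → ∃ (IsSupremum P)


module RealComplex {c ℓ₁ ℓ₂ : Level} (R : CompleteOrderedField c ℓ₁ ℓ₂) where

  open CompleteOrderedField R public renaming (Carrier to ℝ)

  open RawSemiringDefs (RawRing.rawSemiring rawRing) public
    using (_^_) renaming (_×_ to _·_)

  infix 9 ∣_∣

  ∣_∣ : ℝ → ℝ
  ∣ x ∣ = Max._⊔_ totalOrder x (- x)

  fromℕᴿ : ℕ → ℝ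
  fromℕᴿ n = n · 1#

  -- r = x ^ (1/k), for x ≥ 0 and k ≥ 1.
  IsRoot : ℕ → ℝ → ℝ → Set (ℓ₁ ⊔ ℓ₂)
  IsRoot k x r = 0# ≤ r × r ^ k ≈ x

  ConvergesTo : (ℕ → ℝ) → ℝ → Set (c ⊔ ℓ₂)
  ConvergesTo x l =
    ∀ ε → 0# < ε → ∃[ N ] ∀ m → N ℕ.≤ m → ∣ x m - l ∣ < ε

  ℂ : Set c
  ℂ = ℝ × ℝ

  re im : ℂ → ℝ
  re = proj₁
  im = proj₂

  ℂ-rawRing : RawRing c ℓ₁
  ℂ-rawRing = record
    { Carrier = ℂ
    ; _≈_     = λ z w → re z ≈ re w × im z ≈ im w
    ; _+_     = λ z w → (re z + re w , im z + im w)
    ; _*_     = λ z w → ( re z * re w - im z * im w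
                        , re z * im w + im z * re w )
    ; -_      = λ z → (- re z , - im z)
    ; 0#      = (0# , 0#)
    ; 1#      = (1# , 0#)
    }

  open RawRing ℂ-rawRing public using ()
    renaming (_≈_ to _≈ᶜ_; _+_ to _+ᶜ_; _*_ to _*ᶜ_; 0# to 0ᶜ)

  open RawSemiringDefs (RawRing.rawSemiring ℂ-rawRing) public
    using () renaming (_^_ to _^ᶜ_; sum to sumᶜ)

  ofReal : ℝ → ℂ
  ofReal x = (x , 0#)

  i·_ : ℝ → ℂ
  i· x = (0# , x)

  expPartialSum : ℂ → ℕ → ℂ
  expPartialSum z N =
    sumᶜ {N} (λ k → ofReal (fromℕᴿ (toℕ k !) ⁻¹) *ᶜ z ^ᶜ toℕ k)

  -- w = e^z: the exponential series at z converges (coordinatewise) to w.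
  IsExp : ℂ → ℂ → Set (c ⊔ ℓ₂)
  IsExp z w = ConvergesTo (λ N → re (expPartialSum z N)) (re w)
            × ConvergesTo (λ N → im (expPartialSum z N)) (im w)

  -- π is the least positive zero of sin x = im (e^(ix)).
  IsPi : ℝ → Set (c ⊔ ℓ₁ ⊔ ℓ₂)
  IsPi p = 0# < p × IsZeroOfSin p × (∀ x → 0# < x → x < p → ¬ IsZeroOfSin x)
    where
    IsZeroOfSin : ℝ → Set (c ⊔ ℓ₁ ⊔ ℓ₂)
    IsZeroOfSin x = ∃[ e ] IsExp (i· x) e × im e ≈ 0#

  Sector : ℝ → ℝ → ℂ → Set (c ⊔ ℓ₁ ⊔ ℓ₂)
  Sector v θ z = ∃[ ρ ] ∃[ φ ] ∃[ e ]
    0# < ρ × ∣ φ ∣ < θ × IsExp (i· φ) e × z ≈ᶜ ofReal v +ᶜ ofReal ρ *ᶜ e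

  -- A real polynomial a₀ + a₁X + ⋯ + aₙXⁿ is the vector of its coefficients.
  eval : ∀ {n} → Vector ℝ (suc n) → ℂ → ℂ
  eval a z = sumᶜ (λ j → ofReal (a j) *ᶜ z ^ᶜ toℕ j)

  negativeIndices : ∀ {n} → Vector ℝ (suc n) → List (Fin (suc n))
  negativeIndices a = filter (λ j → a j <? 0#) (allFin _)

  sumOver : ∀ {n} → List (Fin (suc n)) → Vector ℝ (suc n) → ℝ
  sumOver js a = foldr _+_ 0# (map a js)

  -- The maximum of non-negative numbers, 0 for the empty list.
  maxOver : ∀ {n} → List (Fin (suc n)) → Vector ℝ (suc n) → ℝ
  maxOver js r = Extrema.max totalOrder 0# (map r js)

{-# OPTIONS --safe #-}
module Submission where

-- If u is a complex number with re (u wᵏ) ≥ 0 for all k ≤ n, then the ℝ-linear functional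
-- x ↦ re (u x) is nonnegative on zᵏ for z = v + w, v ≥ 0, and moreover
--   re (u zⁿ) ≥ v^(n-j) re (u zʲ) + re (u wⁿ)   for j < n,
-- because zⁿ - v^(n-j) zʲ - wⁿ has nonnegative coefficients as a polynomial in v and w.
-- As aₙ v^(n-j) ≥ A := |Σ negative coefficients| whenever aⱼ < 0, the negative terms of
-- re (u f(z)) cost at most aₙ (re (u zⁿ) - re (u wⁿ)), so re (u f(z)) ≥ aₙ re (u wⁿ).
-- For w = ρ e^(iφ) with n|φ| < π, a suitable u is -i, i or 1 according to the sign of φ:
-- then re (u wᵏ) is ρᵏ |sin kφ|, or ρᵏ if φ = 0.
--
-- That sin is positive on (0, π), with π its least positive zero, follows from
-- sin x ≥ x - x² near 0 and the intermediate value theorem; the continuity of sin and the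
-- identity e^(ikφ) = (e^(iφ))ᵏ rest on the addition formula for the exponential series.

open import Defs
open import Algebra.Bundles using (CommutativeRing; RawRing)
import Algebra.Construct.NaturalChoice.Max as Max
import Algebra.Properties.Semiring.Mult as SemiringMult
open import Data.Empty using (⊥-elim)
open import Data.Fin.Base as Fin using (Fin; toℕ; fromℕ)
import Data.Fin.Properties as Fin
open import Data.Integer.Base as ℤ using (ℤ; +_; -[1+_])
import Data.Integer.Properties as ℤ
open import Data.List.Base using (List; []; _∷_; allFin; filter; foldr; map; tabulate)
import Data.List.Extrema as Extrema
open import Data.List.Membership.Propositional using (_∈_)
open import Data.List.Membership.Propositional.Properties using (∈-map⁺; ∈-filter⁺; ∈-allFin)
open import Data.List.Properties using (filter-reject; map-tabulate)
open import Data.List.Relation.Unary.All as All using (All; []; _∷_)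
open import Data.List.Relation.Unary.Any using (here; there)
open import Data.Maybe.Base using (just; nothing)
open import Data.Nat.Base as ℕ using (ℕ; zero; suc; _∸_; _!)
import Data.Nat.Properties as ℕ
open import Data.Product.Base using (_×_; _,_; ∃; ∃-syntax; proj₁; proj₂)
open import Data.Sum.Base using (inj₁; inj₂)
open import Data.Vec.Functional using (Vector)
open import Function.Base using (_∘_; _$_; id)
open import Level using (_⊔_; Lift; lift)
open import Relation.Binary.Bundles using (StrictTotalOrder; TotalOrder)
open import Relation.Binary.Definitions using (WeaklyDecidable; tri<; tri≈; tri>)
open import Relation.Binary.PropositionalEquality as ≡ using (_≡_)
import Relation.Binary.Reasoning.StrictPartialOrder as StrictPartialOrderReasoning
open import Relation.Nullary using (yes; no)
open import Relation.Nullary.Negation using (¬_)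

-- The functional turns f(z) = 0 into a statement about the reals qⱼ = re (u zʲ) ≥ 0. Since v is
-- defined from the sum of all negative coefficients, the different qⱼ with aⱼ < 0 are all replaced
-- by the largest of them, Q, at a cost of at most A Q. As Q is itself one of these qⱼ (or 0), the
-- estimate A qⱼ ≤ aₙ v^(n-j) qⱼ applies to it, although the exponent varies with j.
--
-- The angle π/n is what puts 1, w, ..., wⁿ into one closed half-plane: their arguments 0, φ, ...,
-- nφ lie in [0, π) or in (-π, 0]. For φ ≠ 0 the point 1 is on its boundary, so strictness is asked
-- of wⁿ only, and there it makes the final inequality strict.
--
-- The exponential is given only as a limit of partial sums, so its addition formula is proved by
-- comparing them: the product of two n-th partial sums exceeds the triangle i + j < n by terms
-- whose total norm is at most the difference of the 2n-th and n-th partial sums of the real series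
-- at ∥z∥ + ∥w∥.

-- The canonical map from the integers to a commutative ring

module IntegerCoefficients {c ℓ} (R : CommutativeRing c ℓ) where

  open CommutativeRing R
  open import Algebra.Properties.Ring ring
  open import Algebra.Properties.AbelianGroup +-abelianGroup using (⁻¹-∙-comm)
  open import Algebra.Properties.Semiring.Mult.TCOptimised semiring
    using (×-homo-+; ×1-homo-*) renaming (_×_ to _·_)
  open import Algebra.Properties.CommutativeSemigroup
    (CommutativeRing.+-commutativeSemigroup R) using (interchange)
  open import Algebra.Solver.Ring.AlmostCommutativeRing
  open import Relation.Binary.Reasoning.Setoid setoid
  import Data.Sign.Base as Sign

  -- With the optimised multiples `1 · 1#` computes to `1#`, so the solver constant `:1` denotes
  -- `1#` itself.
  ⟦_⟧ℤ : ℤ → Carrier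
  ⟦ + n ⟧ℤ      = n · 1#
  ⟦ -[1+ n ] ⟧ℤ = - (suc n · 1#)

  suc-· : ∀ n → suc n · 1# ≈ 1# + n · 1#
  suc-· n = ×-homo-+ 1# 1 n

  ⟦⊖⟧ : ∀ m n → ⟦ m ℤ.⊖ n ⟧ℤ ≈ m · 1# - n · 1#
  ⟦⊖⟧ zero    zero    = sym (-‿inverseʳ _)
  ⟦⊖⟧ zero    (suc n) = sym (+-identityˡ _)
  ⟦⊖⟧ (suc m) zero    = sym (trans (+-congˡ -0#≈0#) (+-identityʳ _))
  ⟦⊖⟧ (suc m) (suc n) = begin
    ⟦ suc m ℤ.⊖ suc n ⟧ℤ            ≡⟨ ≡.cong ⟦_⟧ℤ (ℤ.[1+m]⊖[1+n]≡m⊖n m n) ⟩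
    ⟦ m ℤ.⊖ n ⟧ℤ                    ≈⟨ ⟦⊖⟧ m n ⟩
    m · 1# - n · 1#                 ≈⟨ +-identityˡ _ ⟨
    0# + (m · 1# - n · 1#)          ≈⟨ +-congʳ (-‿inverseʳ 1#) ⟨
    1# - 1# + (m · 1# - n · 1#)     ≈⟨ interchange 1# (- 1#) (m · 1#) (- (n · 1#)) ⟩
    1# + m · 1# + (- 1# - n · 1#)   ≈⟨ +-cong (sym (suc-· m)) (trans (⁻¹-∙-comm _ _) (-‿cong (sym (suc-· n)))) ⟩
    suc m · 1# - suc n · 1#         ∎

  ⟦+⟧ : ∀ i j → ⟦ i ℤ.+ j ⟧ℤ ≈ ⟦ i ⟧ℤ + ⟦ j ⟧ℤ
  ⟦+⟧ (+ m)      (+ n)      = ×-homo-+ 1# m n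
  ⟦+⟧ (+ m)      -[1+ n ]   = ⟦⊖⟧ m (suc n)
  ⟦+⟧ -[1+ m ]   (+ n)      = trans (⟦⊖⟧ n (suc m)) (+-comm _ _)
  ⟦+⟧ -[1+ m ]   -[1+ n ]   = begin
    - (suc (suc (m ℕ.+ n)) · 1#)    ≈⟨ -‿cong (suc-· (suc (m ℕ.+ n))) ⟩
    - (1# + (suc m ℕ.+ n) · 1#)      ≈⟨ -‿cong (+-congˡ (×-homo-+ 1# (suc m) n)) ⟩
    - (1# + (suc m · 1# + n · 1#))  ≈⟨ -‿cong (trans (sym (+-assoc _ _ _)) (trans (+-congʳ (+-comm _ _)) (+-assoc _ _ _))) ⟩
    - (suc m · 1# + (1# + n · 1#))  ≈⟨ -‿cong (+-congˡ (suc-· n)) ⟨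
    - (suc m · 1# + suc n · 1#)     ≈⟨ ⁻¹-∙-comm _ _ ⟨
    - (suc m · 1#) - suc n · 1#     ∎

  ⟦-⟧ : ∀ i → ⟦ ℤ.- i ⟧ℤ ≈ - ⟦ i ⟧ℤ
  ⟦-⟧ (+ zero)  = sym -0#≈0#
  ⟦-⟧ (+ suc n) = refl
  ⟦-⟧ -[1+ n ]  = sym (-‿involutive _)

  ⟦-◃⟧ : ∀ n → ⟦ Sign.- ℤ.◃ n ⟧ℤ ≈ - (n · 1#)
  ⟦-◃⟧ zero    = sym -0#≈0#
  ⟦-◃⟧ (suc n) = refl

  ⟦+◃⟧ : ∀ n → ⟦ Sign.+ ℤ.◃ n ⟧ℤ ≈ n · 1#
  ⟦+◃⟧ zero    = refl
  ⟦+◃⟧ (suc n) = refl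

  ⟦*⟧ : ∀ i j → ⟦ i ℤ.* j ⟧ℤ ≈ ⟦ i ⟧ℤ * ⟦ j ⟧ℤ
  ⟦*⟧ (+ m)    (+ n)    = trans (⟦+◃⟧ (m ℕ.* n)) (×1-homo-* m n)
  ⟦*⟧ (+ m)    -[1+ n ] = trans (⟦-◃⟧ (m ℕ.* suc n))
    (trans (-‿cong (×1-homo-* m (suc n))) (-‿distribʳ-* _ _))
  ⟦*⟧ -[1+ m ] (+ n)    = trans (⟦-◃⟧ (suc m ℕ.* n))
    (trans (-‿cong (×1-homo-* (suc m) n)) (-‿distribˡ-* _ _))
  ⟦*⟧ -[1+ m ] -[1+ n ] = trans (⟦+◃⟧ (suc m ℕ.* suc n))
    (trans (×1-homo-* (suc m) (suc n)) (sym ([-x][-y]≈xy _ _)))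
    where
    [-x][-y]≈xy : ∀ x y → - x * - y ≈ x * y
    [-x][-y]≈xy x y = trans (sym (-‿distribˡ-* x (- y)))
      (trans (-‿cong (sym (-‿distribʳ-* x y))) (-‿involutive _))

  homomorphism : ℤ.+-*-rawRing -Raw-AlmostCommutative⟶ fromCommutativeRing R
  homomorphism = record
    { ⟦_⟧    = ⟦_⟧ℤ
    ; +-homo = ⟦+⟧
    ; *-homo = ⟦*⟧
    ; -‿homo = ⟦-⟧
    ; 0-homo = refl
    ; 1-homo = refl
    }

-- Integer coefficients let the solver cancel x - x without deciding equality in R.
module RingSolver {c ℓ} (R : CommutativeRing c ℓ) where

  open CommutativeRing R using (refl)
  open IntegerCoefficients R using (homomorphism)
  open import Algebra.Solver.Ring.AlmostCommutativeRing
    using (fromCommutativeRing; Induced-equivalence)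

  private
    _coeff≟_ : WeaklyDecidable (Induced-equivalence homomorphism)
    i coeff≟ j with i ℤ.≟ j
    ... | yes ≡.refl = just refl
    ... | no  _      = nothing

  open import Algebra.Solver.Ring
    ℤ.+-*-rawRing (fromCommutativeRing R) homomorphism _coeff≟_
    public using (Polynomial; solve; _:=_; _:+_; _:*_; _:-_; :-_; con)

  :0 :1 : ∀ {n} → Polynomial n
  :0 = con (+ 0)
  :1 = con (+ 1)

-- Formal power series: Cauchy products and exponential coefficients

module PowerSeries {c ℓ} (R : CommutativeRing c ℓ) where

  open CommutativeRing R
  open RingSolver R
  open import Algebra.Properties.Semiring.Mult semiring using () renaming (_×_ to _·_)
  open import Relation.Binary.Reasoning.Setoid setoid

  embedℕ : ℕ → Carrier
  embedℕ n = n · 1#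

  -- Splits off the first term, as `sumᶜ` does, so that the two agree by propositional equality.
  partialSum : (ℕ → Carrier) → ℕ → Carrier
  partialSum f zero    = 0#
  partialSum f (suc n) = f 0 + partialSum (f ∘ suc) n

  partialSum-cong : ∀ {f g} → (∀ k → f k ≈ g k) → ∀ n → partialSum f n ≈ partialSum g n
  partialSum-cong f≈g zero    = refl
  partialSum-cong f≈g (suc n) = +-cong (f≈g 0) (partialSum-cong (f≈g ∘ suc) n)

  partialSum-+ : ∀ f m n → partialSum f (m ℕ.+ n) ≈ partialSum f m + partialSum (f ∘ (m ℕ.+_)) n
  partialSum-+ f zero    n = sym (+-identityˡ _)
  partialSum-+ f (suc m) n = trans (+-congˡ (partialSum-+ (f ∘ suc) m n)) (sym (+-assoc _ _ _))

  partialSum-suc : ∀ f n → partialSum f (suc n) ≈ partialSum f n + f n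
  partialSum-suc f zero    = +-comm _ _
  partialSum-suc f (suc n) = trans (+-congˡ (partialSum-suc (f ∘ suc) n)) (sym (+-assoc _ _ _))

  partialSum-zip : ∀ f g n → partialSum (λ k → f k + g k) n ≈ partialSum f n + partialSum g n
  partialSum-zip f g zero    = sym (+-identityˡ _)
  partialSum-zip f g (suc n) = trans (+-congˡ (partialSum-zip (f ∘ suc) (g ∘ suc) n))
    (solve 4 (λ a b c d → a :+ b :+ (c :+ d) := a :+ c :+ (b :+ d)) refl (f 0) (g 0) _ _)

  -- The Cauchy product: the sum of aᵢ bⱼ over i + j = k. Shifting `a` avoids subtracting indices.
  conv : (ℕ → Carrier) → (ℕ → Carrier) → ℕ → Carrier
  conv a b zero    = a 0 * b 0
  conv a b (suc k) = a 0 * b (suc k) + conv (a ∘ suc) b k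

  -- The sum of aᵢ bⱼ over i + j < n, taken row by row.
  triangleSum : (ℕ → Carrier) → (ℕ → Carrier) → ℕ → Carrier
  triangleSum a b zero    = 0#
  triangleSum a b (suc n) = a 0 * partialSum b (suc n) + triangleSum (a ∘ suc) b n

  -- Enlarging the triangle adds the antidiagonal i + j = n. This passes from summation by rows to
  -- summation by antidiagonals.
  triangleSum-suc : ∀ a b n → triangleSum a b (suc n) ≈ triangleSum a b n + conv a b n
  triangleSum-suc a b zero    =
    solve 2 (λ x y → x :* (y :+ :0) :+ :0 := :0 :+ x :* y) refl (a 0) (b 0)
  triangleSum-suc a b (suc n) = begin
    a 0 * partialSum b (suc (suc n)) + triangleSum (a ∘ suc) b (suc n)
      ≈⟨ +-cong (*-congˡ (partialSum-suc b (suc n))) (triangleSum-suc (a ∘ suc) b n) ⟩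
    a 0 * (partialSum b (suc n) + b (suc n)) + (triangleSum (a ∘ suc) b n + conv (a ∘ suc) b n)
      ≈⟨ solve 5 (λ x s y t u → x :* (s :+ y) :+ (t :+ u) := x :* s :+ t :+ (x :* y :+ u)) refl
           (a 0) (partialSum b (suc n)) (b (suc n)) _ _ ⟩
    triangleSum a b (suc n) + conv a b (suc n) ∎

  triangleSum≈partialSum-conv : ∀ a b n → triangleSum a b n ≈ partialSum (conv a b) n
  triangleSum≈partialSum-conv a b zero    = refl
  triangleSum≈partialSum-conv a b (suc n) = begin
    triangleSum a b (suc n)               ≈⟨ triangleSum-suc a b n ⟩
    triangleSum a b n + conv a b n        ≈⟨ +-congʳ (triangleSum≈partialSum-conv a b n) ⟩
    partialSum (conv a b) n + conv a b n  ≈⟨ partialSum-suc (conv a b) n ⟨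
    partialSum (conv a b) (suc n)         ∎

  conv-cong : ∀ {a a′ b b′} → (∀ k → a k ≈ a′ k) → (∀ k → b k ≈ b′ k) →
              ∀ k → conv a b k ≈ conv a′ b′ k
  conv-cong a≈ b≈ zero    = *-cong (a≈ 0) (b≈ 0)
  conv-cong a≈ b≈ (suc k) = +-cong (*-cong (a≈ 0) (b≈ (suc k))) (conv-cong (a≈ ∘ suc) b≈ k)

  conv-distribʳ-+ : ∀ a a′ b k → conv (λ i → a i + a′ i) b k ≈ conv a b k + conv a′ b k
  conv-distribʳ-+ a a′ b zero    = distribʳ _ _ _
  conv-distribʳ-+ a a′ b (suc k) = trans (+-congˡ (conv-distribʳ-+ (a ∘ suc) (a′ ∘ suc) b k))
    (solve 5 (λ x y z t u → (x :+ y) :* z :+ (t :+ u) := x :* z :+ t :+ (y :* z :+ u)) refl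
      (a 0) (a′ 0) (b (suc k)) _ _)

  conv-*ˡ : ∀ x a b k → conv (λ i → x * a i) b k ≈ x * conv a b k
  conv-*ˡ x a b zero    = *-assoc _ _ _
  conv-*ˡ x a b (suc k) = trans (+-congˡ (conv-*ˡ x (a ∘ suc) b k))
    (solve 4 (λ x y z t → x :* y :* z :+ x :* t := x :* (y :* z :+ t)) refl x (a 0) (b (suc k)) _)

  conv-*ʳ : ∀ x a b k → conv a (λ i → x * b i) k ≈ x * conv a b k
  conv-*ʳ x a b zero    = solve 3 (λ x y z → y :* (x :* z) := x :* (y :* z)) refl x (a 0) (b 0)
  conv-*ʳ x a b (suc k) = trans (+-congˡ (conv-*ʳ x (a ∘ suc) b k))
    (solve 4 (λ x y z t → y :* (x :* z) :+ x :* t := x :* (y :* z :+ t)) refl x (a 0) (b (suc k)) _)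

  -- The coefficients of the formal derivative.
  ∂ : (ℕ → Carrier) → ℕ → Carrier
  ∂ a k = embedℕ (suc k) * a (suc k)

  conv-leibniz : ∀ a b k → ∂ (conv a b) k ≈ conv (∂ a) b k + conv a (∂ b) k
  conv-leibniz a b zero    =
    solve 4 (λ x y z t → (:1 :+ :0) :* (x :* y :+ z :* t)
                      := (:1 :+ :0) :* z :* t :+ x :* ((:1 :+ :0) :* y))
      refl (a 0) (b 1) (a 1) (b 0)
  conv-leibniz a b (suc k) = begin
    (1# + κ) * (a 0 * b (suc (suc k)) + (a 1 * b (suc k) + C))
      ≈⟨ solve 6 (λ κ x y z t u →
           (:1 :+ κ) :* (x :* y :+ (z :* t :+ u))
           := x :* ((:1 :+ κ) :* y) :+ (z :* t :+ u) :+ κ :* (z :* t :+ u)) refl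
           κ (a 0) (b (suc (suc k))) (a 1) (b (suc k)) C ⟩
    a 0 * ∂ b (suc k) + (a 1 * b (suc k) + C) + ∂ (conv (a ∘ suc) b) k
      ≈⟨ +-congˡ (conv-leibniz (a ∘ suc) b k) ⟩
    a 0 * ∂ b (suc k) + (a 1 * b (suc k) + C) + (D + E)
      ≈⟨ solve 6 (λ x z t c d e → x :+ (z :* t :+ c) :+ (d :+ e)
                := (:1 :+ :0) :* z :* t :+ (c :+ d) :+ (x :+ e)) refl
           (a 0 * ∂ b (suc k)) (a 1) (b (suc k)) C D E ⟩
    ∂ a 0 * b (suc k) + (C + D) + conv a (∂ b) (suc k)
      -- The copy of `C` left over from the factor 1 + κ raises the weights i + 1 in `∂ (a ∘ suc)`
      -- to the weights i + 2 that the same coefficients carry in `∂ a`.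
      ≈⟨ +-congʳ (+-congˡ (conv-distribʳ-+ (a ∘ suc ∘ suc) (∂ (a ∘ suc)) b k)) ⟨
    ∂ a 0 * b (suc k) + conv (λ i → a (suc (suc i)) + ∂ (a ∘ suc) i) b k + conv a (∂ b) (suc k)
      ≈⟨ +-congʳ (+-congˡ (conv-cong
           (λ i → solve 2 (λ κ x → x :+ κ :* x := (:1 :+ κ) :* x) refl (embedℕ (suc i)) (a (suc (suc i))))
           (λ _ → refl) k)) ⟩
    conv (∂ a) b (suc k) + conv a (∂ b) (suc k) ∎
    where
    κ = embedℕ (suc k)
    C = conv (a ∘ suc ∘ suc) b k
    D = conv (∂ (a ∘ suc)) b k
    E = conv (a ∘ suc) (∂ b) k

  -- p k = x ^ k / k!
  DividedPowers : Carrier → (ℕ → Carrier) → Set ℓ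
  DividedPowers x p = p 0 ≈ 1# × (∀ k → ∂ p k ≈ x * p k)

  -- The binomial theorem without binomial coefficients: if P′ = x P and Q′ = y Q, then (P Q)′ = (x
  -- + y) P Q by the product rule.
  conv-dividedPowers : ∀ {x y p q} → DividedPowers x p → DividedPowers y q →
                       DividedPowers (x + y) (conv p q)
  conv-dividedPowers {x} {y} {p} {q} (p₀ , ∂p) (q₀ , ∂q) =
    trans (*-cong p₀ q₀) (*-identityˡ 1#) , λ k → begin
      ∂ (conv p q) k                                   ≈⟨ conv-leibniz p q k ⟩
      conv (∂ p) q k + conv p (∂ q) k                  ≈⟨ +-cong (conv-cong ∂p (λ _ → refl) k) (conv-cong (λ _ → refl) ∂q k) ⟩
      conv (λ i → x * p i) q k + conv p (λ i → y * q i) k ≈⟨ +-cong (conv-*ˡ x p q k) (conv-*ʳ y p q k) ⟩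
      x * conv p q k + y * conv p q k                  ≈⟨ distribʳ _ _ _ ⟨
      (x + y) * conv p q k                             ∎

  -- The recurrence determines each coefficient from the previous one once k + 1 can be cancelled.
  -- Cancellation is a hypothesis because ℝ and ℂ justify it differently.
  dividedPowers-unique : (∀ k {u v} → embedℕ (suc k) * u ≈ embedℕ (suc k) * v → u ≈ v) →
    ∀ {x p q} → DividedPowers x p → DividedPowers x q → ∀ k → p k ≈ q k
  dividedPowers-unique cancel (p₀ , ∂p) (q₀ , ∂q) zero    = trans p₀ (sym q₀)
  dividedPowers-unique cancel (p₀ , ∂p) (q₀ , ∂q) (suc k) = cancel k
    (trans (∂p k) (trans (*-congˡ (dividedPowers-unique cancel (p₀ , ∂p) (q₀ , ∂q) k)) (sym (∂q k))))

-- Ordered field arithmetic, absolute values, the Archimedean property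

module OrderedField {c ℓ₁ ℓ₂} (R : CompleteOrderedField c ℓ₁ ℓ₂) where

  open RealComplex R
  open RingSolver commutativeRing
  open StrictTotalOrder strictTotalOrder public
    using (irrefl; asym; <-respˡ-≈; <-respʳ-≈; strictPartialOrder)
    renaming (trans to <-trans)
  open TotalOrder totalOrder public
    using ()
    renaming ( refl to ≤-refl; trans to ≤-trans; antisym to ≤-antisym; total to ≤-total
             ; ≤-respˡ-≈ to ≤-respˡ; ≤-respʳ-≈ to ≤-respʳ)
  open Max totalOrder using (x≤x⊔y; x≤y⊔x; ⊔-lub; ⊔-cong; ⊔-sel)
  module ≤-Reasoning = StrictPartialOrderReasoning strictPartialOrder
  open ≤-Reasoning

  <⇒≤ : ∀ {x y} → x < y → x ≤ y
  <⇒≤ = inj₁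

  ≈⇒≤ : ∀ {x y} → x ≈ y → x ≤ y
  ≈⇒≤ = inj₂

  <-≤-trans : ∀ {x y z} → x < y → y ≤ z → x < z
  <-≤-trans x<y (inj₁ y<z) = <-trans x<y y<z
  <-≤-trans x<y (inj₂ y≈z) = <-respʳ-≈ y≈z x<y

  ≤-<-trans : ∀ {x y z} → x ≤ y → y < z → x < z
  ≤-<-trans (inj₁ x<y) y<z = <-trans x<y y<z
  ≤-<-trans (inj₂ x≈y) y<z = <-respˡ-≈ (sym x≈y) y<z

  ≤∧≉⇒< : ∀ {x y} → x ≤ y → ¬ (x ≈ y) → x < y
  ≤∧≉⇒< (inj₁ x<y) _   = x<y
  ≤∧≉⇒< (inj₂ x≈y) x≉y = ⊥-elim (x≉y x≈y)

  <⇒≱ : ∀ {x y} → x < y → ¬ (y ≤ x)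
  <⇒≱ x<y y≤x = irrefl refl (<-≤-trans x<y y≤x)

  ≰⇒> : ∀ {x y} → ¬ (x ≤ y) → y < x
  ≰⇒> {x} {y} x≰y with compare x y
  ... | tri< x<y _ _ = ⊥-elim (x≰y (inj₁ x<y))
  ... | tri≈ _ x≈y _ = ⊥-elim (x≰y (inj₂ x≈y))
  ... | tri> _ _ y<x = y<x

  ≮⇒≥ : ∀ {x y} → ¬ (x < y) → y ≤ x
  ≮⇒≥ {x} {y} x≮y with compare x y
  ... | tri< x<y _ _ = ⊥-elim (x≮y x<y)
  ... | tri≈ _ x≈y _ = inj₂ (sym x≈y)
  ... | tri> _ _ y<x = inj₁ y<x

  -- With the ring solver checking the second argument, these two do linear arithmetic.
  <-transfer : ∀ {x y p q} → x < y → y - x ≈ q - p → p < q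
  <-transfer {x} {y} {p} {q} x<y eq = begin-strict
    p                ≈⟨ solve 2 (λ x p → p := x :+ (p :- x)) refl x p ⟩
    x + (p - x)      <⟨ +-monoˡ-< (p - x) x<y ⟩
    y + (p - x)      ≈⟨ solve 3 (λ x y p → y :+ (p :- x) := y :- x :+ p) refl x y p ⟩
    y - x + p        ≈⟨ +-congʳ eq ⟩
    q - p + p        ≈⟨ solve 2 (λ q p → q :- p :+ p := q) refl q p ⟩
    q                ∎

  ≤-transfer : ∀ {x y p q} → x ≤ y → y - x ≈ q - p → p ≤ q
  ≤-transfer (inj₁ x<y) eq = inj₁ (<-transfer x<y eq)
  ≤-transfer {x} {y} {p} {q} (inj₂ x≈y) eq = inj₂ $ begin-equality
    p          ≈⟨ solve 2 (λ x p → p := x :- x :+ p) refl x p ⟩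
    x - x + p  ≈⟨ +-congʳ (+-congʳ x≈y) ⟩
    y - x + p  ≈⟨ +-congʳ eq ⟩
    q - p + p  ≈⟨ solve 2 (λ q p → q :- p :+ p := q) refl q p ⟩
    q          ∎

  +-monoʳ-< : ∀ z {x y} → x < y → z + x < z + y
  +-monoʳ-< z {x} {y} x<y = <-transfer x<y
    (solve 3 (λ x y z → y :- x := z :+ y :- (z :+ x)) refl x y z)

  +-monoʳ-≤ : ∀ z {x y} → x ≤ y → z + x ≤ z + y
  +-monoʳ-≤ z {x} {y} x≤y = ≤-transfer x≤y
    (solve 3 (λ x y z → y :- x := z :+ y :- (z :+ x)) refl x y z)

  +-monoˡ-≤ : ∀ z {x y} → x ≤ y → x + z ≤ y + z
  +-monoˡ-≤ z {x} {y} x≤y = ≤-transfer x≤y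
    (solve 3 (λ x y z → y :- x := y :+ z :- (x :+ z)) refl x y z)

  +-mono-≤ : ∀ {x y u v} → x ≤ y → u ≤ v → x + u ≤ y + v
  +-mono-≤ {y = y} {u} x≤y u≤v = ≤-trans (+-monoˡ-≤ u x≤y) (+-monoʳ-≤ y u≤v)

  +-mono-<-≤ : ∀ {x y u v} → x < y → u ≤ v → x + u < y + v
  +-mono-<-≤ {y = y} {u} x<y u≤v = <-≤-trans (+-monoˡ-< u x<y) (+-monoʳ-≤ y u≤v)

  +-nonneg : ∀ {x y} → 0# ≤ x → 0# ≤ y → 0# ≤ x + y
  +-nonneg 0≤x 0≤y = ≤-respˡ (+-identityˡ 0#) (+-mono-≤ 0≤x 0≤y)

  ≤⇒0≤- : ∀ {x y} → x ≤ y → 0# ≤ y - x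
  ≤⇒0≤- {x} {y} x≤y = ≤-transfer x≤y (solve 2 (λ x y → y :- x := y :- x :- :0) refl x y)

  0≤-⇒≤ : ∀ {x y} → 0# ≤ y - x → x ≤ y
  0≤-⇒≤ {x} {y} p = ≤-transfer p (solve 2 (λ x y → y :- x :- :0 := y :- x) refl x y)

  <⇒0<- : ∀ {x y} → x < y → 0# < y - x
  <⇒0<- {x} {y} x<y = <-transfer x<y (solve 2 (λ x y → y :- x := y :- x :- :0) refl x y)

  *-nonneg : ∀ {x y} → 0# ≤ x → 0# ≤ y → 0# ≤ x * y
  *-nonneg (inj₁ 0<x) (inj₁ 0<y) = inj₁ (*-pos 0<x 0<y)
  *-nonneg (inj₁ 0<x) (inj₂ 0≈y) = inj₂ (sym (trans (*-congˡ (sym 0≈y)) (zeroʳ _)))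
  *-nonneg (inj₂ 0≈x) _          = inj₂ (sym (trans (*-congʳ (sym 0≈x)) (zeroˡ _)))

  *-monoʳ-≤ : ∀ {z x y} → 0# ≤ z → x ≤ y → z * x ≤ z * y
  *-monoʳ-≤ {z} {x} {y} 0≤z x≤y = ≤-transfer (*-nonneg 0≤z (≤⇒0≤- x≤y))
    (solve 3 (λ x y z → z :* (y :- x) :- :0 := z :* y :- z :* x) refl x y z)

  *-monoʳ-< : ∀ {z x y} → 0# < z → x < y → z * x < z * y
  *-monoʳ-< {z} {x} {y} 0<z x<y = <-transfer (*-pos 0<z (<⇒0<- x<y))
    (solve 3 (λ x y z → z :* (y :- x) :- :0 := z :* y :- z :* x) refl x y z)

  *-mono-≤ : ∀ {x y u v} → 0# ≤ u → x ≤ y → u ≤ v → 0# ≤ y → x * u ≤ y * v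
  *-mono-≤ {x} {y} {u} {v} 0≤u x≤y u≤v 0≤y = begin
    x * u  ≈⟨ *-comm x u ⟩
    u * x  ≤⟨ *-monoʳ-≤ 0≤u x≤y ⟩
    u * y  ≈⟨ *-comm u y ⟩
    y * u  ≤⟨ *-monoʳ-≤ 0≤y u≤v ⟩
    y * v  ∎

  *-cancelˡ-< : ∀ {z x y} → 0# ≤ z → z * x < z * y → x < y
  *-cancelˡ-< 0≤z zx<zy = ≰⇒> (λ y≤x → <⇒≱ zx<zy (*-monoʳ-≤ 0≤z y≤x))

  *-cancelˡ-≤ : ∀ {z x y} → 0# < z → z * x ≤ z * y → x ≤ y
  *-cancelˡ-≤ 0<z zx≤zy = ≮⇒≥ (λ y<x → <⇒≱ (*-monoʳ-< 0<z y<x) zx≤zy)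

  *-cancelˡ-≈ : ∀ {z x y} → 0# < z → z * x ≈ z * y → x ≈ y
  *-cancelˡ-≈ 0<z zx≈zy = ≤-antisym (*-cancelˡ-≤ 0<z (≈⇒≤ zx≈zy)) (*-cancelˡ-≤ 0<z (≈⇒≤ (sym zx≈zy)))

  0<1 : 0# < 1#
  0<1 with compare 0# 1#
  ... | tri< 0<1 _ _ = 0<1
  ... | tri≈ _ 0≈1 _ = ⊥-elim (0≉1 0≈1)
  ... | tri> _ _ 1<0 = <-transfer (*-pos (<⇒0<- 1<0) (<⇒0<- 1<0))
    (solve 0 ((:0 :- :1) :* (:0 :- :1) :- :0
              := :1 :- :0) refl)

  0≤1 : 0# ≤ 1#
  0≤1 = <⇒≤ 0<1

  fromℕᴿ-nonneg : ∀ n → 0# ≤ fromℕᴿ n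
  fromℕᴿ-nonneg zero    = ≤-refl
  fromℕᴿ-nonneg (suc n) = +-nonneg 0≤1 (fromℕᴿ-nonneg n)

  fromℕᴿ-pos : ∀ n → 0# < fromℕᴿ (suc n)
  fromℕᴿ-pos n = <-≤-trans 0<1 (≤-respˡ (+-identityʳ 1#) (+-monoʳ-≤ 1# (fromℕᴿ-nonneg n)))

  fromℕᴿ-mono : ∀ {m n} → m ℕ.≤ n → fromℕᴿ m ≤ fromℕᴿ n
  fromℕᴿ-mono {n = n} ℕ.z≤n = fromℕᴿ-nonneg n
  fromℕᴿ-mono (ℕ.s≤s m≤n)   = +-monoʳ-≤ 1# (fromℕᴿ-mono m≤n)

  >⇒≉0 : ∀ {x} → 0# < x → ¬ (x ≈ 0#)
  >⇒≉0 0<x x≈0 = irrefl (sym x≈0) 0<x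

  x*[y/x]≈y : ∀ {x} → 0# < x → ∀ y → x * (y / x) ≈ y
  x*[y/x]≈y {x} 0<x y = begin-equality
    x * (y * x ⁻¹)  ≈⟨ solve 3 (λ x y i → x :* (y :* i) := y :* (x :* i)) refl x y (x ⁻¹) ⟩
    y * (x * x ⁻¹)  ≈⟨ *-congˡ (*-inverseʳ x (>⇒≉0 0<x)) ⟩
    y * 1#          ≈⟨ *-identityʳ y ⟩
    y               ∎

  /-pos : ∀ {x y} → 0# < x → 0# < y → 0# < x / y
  /-pos {x} {y} 0<x 0<y = *-cancelˡ-< (<⇒≤ 0<y) $ begin-strict
    y * 0#       ≈⟨ zeroʳ y ⟩
    0#           <⟨ 0<x ⟩
    x            ≈⟨ x*[y/x]≈y 0<y x ⟨
    y * (x / y)  ∎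

  ⁻¹-pos : ∀ {x} → 0# < x → 0# < x ⁻¹
  ⁻¹-pos 0<x = <-respʳ-≈ (*-identityˡ _) (/-pos 0<1 0<x)

  common-lower-bound : ∀ {x y} → 0# < x → 0# < y → ∃[ z ] 0# < z × z ≤ x × z ≤ y
  common-lower-bound {x} {y} 0<x 0<y with ≤-total x y
  ... | inj₁ x≤y = x , 0<x , ≤-refl , x≤y
  ... | inj₂ y≤x = y , 0<y , y≤x , ≤-refl

  -- Some estimates of absolute values are proved doubled, where they become sums of nonnegative
  -- terms; this removes the factor 2 without a division.
  0≤x+x⇒0≤x : ∀ {x} → 0# ≤ x + x → 0# ≤ x
  0≤x+x⇒0≤x {x} p = ≮⇒≥ (λ x<0 → <⇒≱ (<-respʳ-≈ (+-identityʳ 0#) (+-mono-<-≤ x<0 (<⇒≤ x<0))) p)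

  ^-nonneg : ∀ {x} → 0# ≤ x → ∀ n → 0# ≤ x ^ n
  ^-nonneg 0≤x zero    = 0≤1
  ^-nonneg 0≤x (suc n) = *-nonneg 0≤x (^-nonneg 0≤x n)

  ^-pos : ∀ {x} → 0# < x → ∀ n → 0# < x ^ n
  ^-pos 0<x zero    = 0<1
  ^-pos 0<x (suc n) = *-pos 0<x (^-pos 0<x n)

  ^-mono-≤ : ∀ {x y} → 0# ≤ x → x ≤ y → ∀ n → x ^ n ≤ y ^ n
  ^-mono-≤ 0≤x x≤y zero    = ≤-refl
  ^-mono-≤ 0≤x x≤y (suc n) =
    *-mono-≤ (^-nonneg 0≤x n) x≤y (^-mono-≤ 0≤x x≤y n) (≤-trans 0≤x x≤y)

  x≤∣x∣ : ∀ x → x ≤ ∣ x ∣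
  x≤∣x∣ x = x≤x⊔y x (- x)

  -x≤∣x∣ : ∀ x → - x ≤ ∣ x ∣
  -x≤∣x∣ x = x≤y⊔x x (- x)

  ∣∣-lub : ∀ {x b} → x ≤ b → - x ≤ b → ∣ x ∣ ≤ b
  ∣∣-lub = ⊔-lub

  ∣∣-lub-< : ∀ {x b} → x < b → - x < b → ∣ x ∣ < b
  ∣∣-lub-< {x} x<b -x<b with ⊔-sel x (- x)
  ... | inj₁ eq = <-respˡ-≈ (sym eq) x<b
  ... | inj₂ eq = <-respˡ-≈ (sym eq) -x<b

  ∣∣-cong : ∀ {x y} → x ≈ y → ∣ x ∣ ≈ ∣ y ∣
  ∣∣-cong x≈y = ⊔-cong x≈y (-‿cong x≈y)

  ∣x∣≥0 : ∀ x → 0# ≤ ∣ x ∣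
  ∣x∣≥0 x = 0≤x+x⇒0≤x (≤-respˡ (-‿inverseʳ x) (+-mono-≤ (x≤∣x∣ x) (-x≤∣x∣ x)))

  ∣x∣≈x : ∀ {x} → 0# ≤ x → ∣ x ∣ ≈ x
  ∣x∣≈x {x} 0≤x = ≤-antisym
    (∣∣-lub ≤-refl (≤-transfer (+-nonneg 0≤x 0≤x)
      (solve 1 (λ x → x :+ x :- :0 := x :- (:- x)) refl x)))
    (x≤∣x∣ x)

  ∣-x∣≤∣x∣ : ∀ x → ∣ - x ∣ ≤ ∣ x ∣
  ∣-x∣≤∣x∣ x = ∣∣-lub (-x≤∣x∣ x) (≤-respˡ (solve 1 (λ x → x := :- (:- x)) refl x) (x≤∣x∣ x))

  ∣x+y∣≤∣x∣+∣y∣ : ∀ x y → ∣ x + y ∣ ≤ ∣ x ∣ + ∣ y ∣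
  ∣x+y∣≤∣x∣+∣y∣ x y = ∣∣-lub (+-mono-≤ (x≤∣x∣ x) (x≤∣x∣ y))
    (≤-respˡ (solve 2 (λ x y → :- x :- y := :- (x :+ y)) refl x y)
      (+-mono-≤ (-x≤∣x∣ x) (-x≤∣x∣ y)))

  ∣x-y∣≤∣x∣+∣y∣ : ∀ x y → ∣ x - y ∣ ≤ ∣ x ∣ + ∣ y ∣
  ∣x-y∣≤∣x∣+∣y∣ x y = ≤-trans (∣x+y∣≤∣x∣+∣y∣ x (- y)) (+-monoʳ-≤ ∣ x ∣ (∣-x∣≤∣x∣ y))

  -- 2(|x||y| ∓ xy) = (|x| - x)(|y| ± y) + (|x| + x)(|y| ∓ y).
  ∣x*y∣≤∣x∣*∣y∣ : ∀ x y → ∣ x * y ∣ ≤ ∣ x ∣ * ∣ y ∣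
  ∣x*y∣≤∣x∣*∣y∣ x y = ∣∣-lub
    (0≤-⇒≤ (0≤x+x⇒0≤x (≤-respʳ
      (solve 4 (λ x y a b → (a :- x) :* (b :- (:- y)) :+ (a :- (:- x)) :* (b :- y)
                         := a :* b :- x :* y :+ (a :* b :- x :* y)) refl x y ∣ x ∣ ∣ y ∣)
      (+-nonneg (*-nonneg (≤⇒0≤- (x≤∣x∣ x)) (≤⇒0≤- (-x≤∣x∣ y)))
                (*-nonneg (≤⇒0≤- (-x≤∣x∣ x)) (≤⇒0≤- (x≤∣x∣ y)))))))
    (0≤-⇒≤ (0≤x+x⇒0≤x (≤-respʳ
      (solve 4 (λ x y a b → (a :- x) :* (b :- y) :+ (a :- (:- x)) :* (b :- (:- y))
                         := a :* b :- (:- (x :* y)) :+ (a :* b :- (:- (x :* y)))) refl x y ∣ x ∣ ∣ y ∣)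
      (+-nonneg (*-nonneg (≤⇒0≤- (x≤∣x∣ x)) (≤⇒0≤- (x≤∣x∣ y)))
                (*-nonneg (≤⇒0≤- (-x≤∣x∣ x)) (≤⇒0≤- (-x≤∣x∣ y)))))))

  -- For 0 < x let s be the supremum of the naturals up to x. Some such n exceeds s - 1, so n + 1
  -- exceeds s and cannot be at most x. Cutting the set off at x bounds it outright and yields the
  -- witness directly.
  archimedean : ∀ x → ∃[ n ] x < fromℕᴿ n
  archimedean x with compare x 0#
  ... | tri< x<0 _ _ = 0 , x<0
  ... | tri≈ _ x≈0 _ = 1 , ≤-<-trans (≈⇒≤ x≈0) (fromℕᴿ-pos 0)
  ... | tri> _ _ 0<x = beyond (complete Below (0# , lift (0 , refl , <⇒≤ 0<x))
                         (x , λ { y (lift (n , y≈n , n≤x)) → ≤-respˡ (sym y≈n) n≤x }))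
    where
    Below : ℝ → Set (c ⊔ ℓ₁ ⊔ ℓ₂)
    Below y = Lift c (∃[ n ] y ≈ fromℕᴿ n × fromℕᴿ n ≤ x)
    beyond : ∃ (IsSupremum Below) → ∃[ n ] x < fromℕᴿ n
    beyond (s , upper , close) with close (s - 1#)
      (<-transfer 0<1 (solve 1 (λ s → :1 :- :0 := s :- (s :- :1)) refl s))
    ... | y , lift (n , y≈n , n≤x) , s-1<y =
      suc n , ≰⇒> (λ n+1≤x → <⇒≱ (s<n+1 s n (<-respʳ-≈ y≈n s-1<y)) (upper _ (lift (suc n , refl , n+1≤x))))
      where
      s<n+1 : ∀ s n → s - 1# < fromℕᴿ n → s < fromℕᴿ (suc n)
      s<n+1 s n p = <-transfer p
        (solve 2 (λ s n → n :- (s :- :1) := :1 :+ n :- s) refl s (fromℕᴿ n))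

-- Limits, convergence tests and the real exponential series

module Limits {c ℓ₁ ℓ₂} (R : CompleteOrderedField c ℓ₁ ℓ₂) where

  open RealComplex R
  open OrderedField R
  open RingSolver commutativeRing
  open PowerSeries commutativeRing
  open ≤-Reasoning

  halve : ∀ {ε} → 0# < ε → ∃[ δ ] 0# < δ × δ + δ ≈ ε
  halve {ε} 0<ε = ε / fromℕᴿ 2 , /-pos 0<ε (fromℕᴿ-pos 1) ,
    trans (solve 1 (λ x → x :+ x := (:1 :+ (:1 :+ :0)) :* x) refl (ε / fromℕᴿ 2))
          (x*[y/x]≈y (fromℕᴿ-pos 1) ε)

  ∣x-y∣<⇒x<y+ : ∀ {x y ε} → ∣ x - y ∣ < ε → x < y + ε
  ∣x-y∣<⇒x<y+ {x} {y} {ε} p = <-transfer (≤-<-trans (x≤∣x∣ (x - y)) p)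
    (solve 3 (λ x y e → e :- (x :- y) := y :+ e :- x) refl x y ε)

  ∣x-y∣<⇒y<x+ : ∀ {x y ε} → ∣ x - y ∣ < ε → y < x + ε
  ∣x-y∣<⇒y<x+ {x} {y} {ε} p = <-transfer (≤-<-trans (-x≤∣x∣ (x - y)) p)
    (solve 3 (λ x y e → e :- (:- (x :- y)) := x :+ e :- y) refl x y ε)

  lim-const : ∀ x → ConvergesTo (λ _ → x) x
  lim-const x ε 0<ε = 0 , λ _ _ → ≤-<-trans
    (≈⇒≤ (trans (∣∣-cong (-‿inverseʳ x)) (∣x∣≈x ≤-refl))) 0<ε

  lim-cong : ∀ {f g l} → (∀ n → f n ≈ g n) → ConvergesTo f l → ConvergesTo g l
  lim-cong f≈g f→l ε 0<ε = let N , close = f→l ε 0<ε in N , λ m N≤m → <-respˡ-≈ (∣∣-cong (+-congʳ (f≈g m))) (close m N≤m)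

  lim-congʳ : ∀ {f k l} → k ≈ l → ConvergesTo f k → ConvergesTo f l
  lim-congʳ k≈l f→k ε 0<ε = let N , close = f→k ε 0<ε in N , λ m N≤m → <-respˡ-≈ (∣∣-cong (+-congˡ (-‿cong k≈l))) (close m N≤m)

  lim-+ : ∀ {f g k l} → ConvergesTo f k → ConvergesTo g l → ConvergesTo (λ n → f n + g n) (k + l)
  lim-+ {f} {g} {k} {l} f→k g→l ε 0<ε =
    let δ , 0<δ , δ+δ≈ε = halve 0<ε
        M , f-close = f→k δ 0<δ
        N , g-close = g→l δ 0<δ
    in M ℕ.+ N , λ m M+N≤m → bound δ δ+δ≈ε (f m) (g m)
         (f-close m (ℕ.m+n≤o⇒m≤o M M+N≤m)) (g-close m (ℕ.m+n≤o⇒n≤o M M+N≤m))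
    where
    bound : ∀ δ → δ + δ ≈ ε → ∀ x y → ∣ x - k ∣ < δ → ∣ y - l ∣ < δ → ∣ x + y - (k + l) ∣ < ε
    bound δ δ+δ≈ε x y p q = begin-strict
      ∣ x + y - (k + l) ∣      ≈⟨ ∣∣-cong (solve 4 (λ a b c d → a :+ b :- (c :+ d) := a :- c :+ (b :- d)) refl x y k l) ⟩
      ∣ x - k + (y - l) ∣      ≤⟨ ∣x+y∣≤∣x∣+∣y∣ _ _ ⟩
      ∣ x - k ∣ + ∣ y - l ∣    <⟨ +-mono-<-≤ p (<⇒≤ q) ⟩
      δ + δ                    ≈⟨ δ+δ≈ε ⟩
      ε                        ∎

  lim-neg : ∀ {f l} → ConvergesTo f l → ConvergesTo (λ n → - f n) (- l)
  lim-neg {f} {l} f→l ε 0<ε = let N , close = f→l ε 0<ε in N , λ m N≤m → begin-strict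
    ∣ - f m - - l ∣    ≈⟨ ∣∣-cong (solve 2 (λ a b → :- a :- (:- b) := :- (a :- b)) refl (f m) l) ⟩
    ∣ - (f m - l) ∣    ≤⟨ ∣-x∣≤∣x∣ _ ⟩
    ∣ f m - l ∣        <⟨ close m N≤m ⟩
    ε                  ∎

  lim-minus : ∀ {f g k l} → ConvergesTo f k → ConvergesTo g l → ConvergesTo (λ n → f n - g n) (k - l)
  lim-minus f→k g→l = lim-+ f→k (lim-neg g→l)

  lim-* : ∀ {f g k l} → ConvergesTo f k → ConvergesTo g l → ConvergesTo (λ n → f n * g n) (k * l)
  lim-* {f} {g} {k} {l} f→k g→l ε 0<ε = close-product (common-lower-bound 0<1 (/-pos 0<ε 0<C))
    where
    -- For δ ≤ 1 the three terms into which `x * y - k * l` is split have total size at most δ `A`;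
    -- the further 1 in `C` makes the bound strict.
    A = 1# + (∣ l ∣ + ∣ k ∣)
    C = 1# + A
    0<C : 0# < C
    0<C = <-≤-trans 0<1 (≤-respˡ (+-identityʳ 1#)
      (+-monoʳ-≤ 1# (+-nonneg 0≤1 (+-nonneg (∣x∣≥0 l) (∣x∣≥0 k)))))
    close-product : ∃[ δ ] 0# < δ × δ ≤ 1# × δ ≤ ε / C →
                    ∃[ N ] ∀ m → N ℕ.≤ m → ∣ f m * g m - k * l ∣ < ε
    close-product (δ , 0<δ , δ≤1 , δ≤ε/C) =
      let M , f-close = f→k δ 0<δ
          N , g-close = g→l δ 0<δ
      in M ℕ.+ N , λ m M+N≤m → bound (f m) (g m)
           (<⇒≤ (f-close m (ℕ.m+n≤o⇒m≤o M M+N≤m))) (<⇒≤ (g-close m (ℕ.m+n≤o⇒n≤o M M+N≤m)))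
      where
      bound : ∀ x y → ∣ x - k ∣ ≤ δ → ∣ y - l ∣ ≤ δ → ∣ x * y - k * l ∣ < ε
      bound x y p q = begin-strict
        ∣ x * y - k * l ∣
          ≈⟨ ∣∣-cong (solve 4 (λ x y k l → x :* y :- k :* l
               := (x :- k) :* (y :- l) :+ ((x :- k) :* l :+ (y :- l) :* k)) refl x y k l) ⟩
        ∣ (x - k) * (y - l) + ((x - k) * l + (y - l) * k) ∣
          ≤⟨ ≤-trans (∣x+y∣≤∣x∣+∣y∣ _ _) (+-monoʳ-≤ _ (∣x+y∣≤∣x∣+∣y∣ _ _)) ⟩
        ∣ (x - k) * (y - l) ∣ + (∣ (x - k) * l ∣ + ∣ (y - l) * k ∣)
          ≤⟨ +-mono-≤ (mul p (≤-trans q δ≤1)) (+-mono-≤ (mul p ≤-refl) (mul q ≤-refl)) ⟩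
        δ * 1# + (δ * ∣ l ∣ + δ * ∣ k ∣)
          ≈⟨ solve 3 (λ d l k → d :* :1 :+ (d :* l :+ d :* k)
               := :0 :+ d :* (:1 :+ (l :+ k))) refl δ ∣ l ∣ ∣ k ∣ ⟩
        0# + δ * A
          <⟨ +-monoˡ-< (δ * A) 0<δ ⟩
        δ + δ * A
          ≈⟨ solve 2 (λ d a → d :+ d :* a := (:1 :+ a) :* d) refl δ A ⟩
        C * δ
          ≤⟨ *-monoʳ-≤ (<⇒≤ 0<C) δ≤ε/C ⟩
        C * (ε / C)
          ≈⟨ x*[y/x]≈y 0<C ε ⟩
        ε ∎
        where
        mul : ∀ {u v b} → ∣ u ∣ ≤ δ → ∣ v ∣ ≤ b → ∣ u * v ∣ ≤ δ * b
        mul {u} {v} r s = ≤-trans (∣x*y∣≤∣x∣*∣y∣ u v) (*-mono-≤ (∣x∣≥0 v) r s (<⇒≤ 0<δ))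

  lim-mono-≤ : ∀ {f g k l} N → (∀ m → N ℕ.≤ m → f m ≤ g m) →
               ConvergesTo f k → ConvergesTo g l → k ≤ l
  lim-mono-≤ {f} {g} {k} {l} N f≤g f→k g→l = ≮⇒≥ absurd
    where
    absurd : ¬ (l < k)
    absurd l<k = irrefl refl $ begin-strict
      k                ≤⟨ <⇒≤ (∣x-y∣<⇒y<x+ (proj₂ (f→k δ 0<δ) m (ℕ.≤-trans (ℕ.m≤m+n P Q) (ℕ.m≤n+m _ N)))) ⟩
      f m + δ          ≤⟨ +-monoˡ-≤ δ (f≤g m (ℕ.m≤m+n N _)) ⟩
      g m + δ          <⟨ +-monoˡ-< δ (∣x-y∣<⇒x<y+ (proj₂ (g→l δ 0<δ) m (ℕ.≤-trans (ℕ.m≤n+m Q P) (ℕ.m≤n+m _ N)))) ⟩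
      l + δ + δ        ≈⟨ trans (+-assoc _ _ _) (+-congˡ (proj₂ (proj₂ half))) ⟩
      l + (k - l)      ≈⟨ solve 2 (λ k l → l :+ (k :- l) := k) refl k l ⟩
      k                ∎
      where
      half = halve (<⇒0<- l<k)
      δ = proj₁ half
      0<δ = proj₁ (proj₂ half)
      P = proj₁ (f→k δ 0<δ)
      Q = proj₁ (g→l δ 0<δ)
      m = N ℕ.+ (P ℕ.+ Q)

  lim-unique : ∀ {f k l} → ConvergesTo f k → ConvergesTo f l → k ≈ l
  lim-unique f→k f→l = ≤-antisym (lim-mono-≤ 0 (λ _ _ → ≤-refl) f→k f→l)
                                 (lim-mono-≤ 0 (λ _ _ → ≤-refl) f→l f→k)

  lim-∣∣-≤ : ∀ {f l b} N → (∀ m → N ℕ.≤ m → ∣ f m ∣ ≤ b) → ConvergesTo f l → ∣ l ∣ ≤ b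
  lim-∣∣-≤ {f} {b = b} N ∣f∣≤b f→l = ∣∣-lub
    (lim-mono-≤ N (λ m N≤m → ≤-trans (x≤∣x∣ (f m)) (∣f∣≤b m N≤m)) f→l (lim-const b))
    (lim-mono-≤ N (λ m N≤m → ≤-trans (-x≤∣x∣ (f m)) (∣f∣≤b m N≤m)) (lim-neg f→l) (lim-const b))

  lim-squeeze : ∀ {f g} → (∀ n → ∣ f n ∣ ≤ g n) → ConvergesTo g 0# → ConvergesTo f 0#
  lim-squeeze {f} {g} ∣f∣≤g g→0 ε 0<ε = let N , close = g→0 ε 0<ε in N , λ m N≤m → begin-strict
    ∣ f m - 0# ∣  ≈⟨ ∣∣-cong (solve 1 (λ x → x :- :0 := x) refl (f m)) ⟩
    ∣ f m ∣       ≤⟨ ∣f∣≤g m ⟩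
    g m           ≈⟨ solve 1 (λ x → x := x :- :0) refl (g m) ⟩
    g m - 0#      ≤⟨ x≤∣x∣ _ ⟩
    ∣ g m - 0# ∣  <⟨ close m N≤m ⟩
    ε             ∎

  lim-double : ∀ {f l} → ConvergesTo f l → ConvergesTo (λ n → f (n ℕ.+ n)) l
  lim-double f→l ε 0<ε = let N , close = f→l ε 0<ε in N , λ m N≤m → close (m ℕ.+ m) (ℕ.≤-trans N≤m (ℕ.m≤m+n m m))

  monotone-convergence : ∀ {f b} → (∀ m n → f m ≤ f (m ℕ.+ n)) → (∀ n → f n ≤ b) → ∃[ l ] ConvergesTo f l
  monotone-convergence {f} {b} f-mono f≤b = toSup
    (complete Range (f 0 , lift (0 , refl)) (b , λ { y (lift (n , y≈fn)) → ≤-respˡ (sym y≈fn) (f≤b n) }))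
    where
    Range : ℝ → Set (c ⊔ ℓ₁ ⊔ ℓ₂)
    Range y = Lift (c ⊔ ℓ₂) (∃[ n ] y ≈ f n)
    toSup : ∃ (IsSupremum Range) → ∃[ l ] ConvergesTo f l
    toSup (s , upper , close) = s , f→s
      where
      f→s : ConvergesTo f s
      f→s ε 0<ε = fromClose (close (s - ε)
        (<-transfer 0<ε (solve 2 (λ s e → e :- :0 := s :- (s :- e)) refl s ε)))
        where
        near : ∀ N m → s - ε < f N → f N ≤ f m → ∣ f m - s ∣ < ε
        near N m s-ε<fN fN≤fm = ∣∣-lub-<
          (<-transfer (≤-<-trans (upper _ (lift (m , refl))) (<-respˡ-≈ (+-identityʳ s) (+-monoʳ-< s 0<ε)))
            (solve 3 (λ x s e → s :+ e :- x := e :- (x :- s)) refl (f m) s ε))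
          (<-transfer (<-≤-trans s-ε<fN fN≤fm)
            (solve 3 (λ x s e → x :- (s :- e) := e :- (:- (x :- s))) refl (f m) s ε))
        fromClose : ∃[ y ] Range y × s - ε < y → ∃[ N ] ∀ m → N ℕ.≤ m → ∣ f m - s ∣ < ε
        fromClose (y , lift (N , y≈fN) , s-ε<y) = N , λ m N≤m →
          near N m (<-respʳ-≈ y≈fN s-ε<y) (≡.subst (λ k → f N ≤ f k) (ℕ.m+[n∸m]≡n N≤m) (f-mono N _))

  partialSum-mono-≤ : ∀ {f g} → (∀ k → f k ≤ g k) → ∀ n → partialSum f n ≤ partialSum g n
  partialSum-mono-≤ f≤g zero    = ≤-refl
  partialSum-mono-≤ f≤g (suc n) = +-mono-≤ (f≤g 0) (partialSum-mono-≤ (f≤g ∘ suc) n)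

  partialSum-nonneg : ∀ {f} → (∀ k → 0# ≤ f k) → ∀ n → 0# ≤ partialSum f n
  partialSum-nonneg 0≤f zero    = ≤-refl
  partialSum-nonneg 0≤f (suc n) = +-nonneg (0≤f 0) (partialSum-nonneg (0≤f ∘ suc) n)

  partialSum-increasing : ∀ {f} → (∀ k → 0# ≤ f k) → ∀ m n → partialSum f m ≤ partialSum f (m ℕ.+ n)
  partialSum-increasing {f} 0≤f m n = begin
    partialSum f m                                ≈⟨ +-identityʳ _ ⟨
    partialSum f m + 0#                           ≤⟨ +-monoʳ-≤ _ (partialSum-nonneg (0≤f ∘ (m ℕ.+_)) n) ⟩
    partialSum f m + partialSum (f ∘ (m ℕ.+_)) n  ≈⟨ partialSum-+ f m n ⟨
    partialSum f (m ℕ.+ n)                        ∎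

  -- Both f + g and g have nonnegative terms and bounded partial sums, so monotone convergence
  -- applies to each; f is their difference.
  comparison-test : ∀ {f g b} → (∀ k → ∣ f k ∣ ≤ g k) → (∀ n → partialSum g n ≤ b) →
                    ∃[ l ] ConvergesTo (partialSum f) l
  comparison-test {f} {g} {b} ∣f∣≤g Σg≤b =
    let k , f+g→k = monotone-convergence (partialSum-increasing 0≤f+g) Σ[f+g]≤b+b
        l , g→l   = monotone-convergence (partialSum-increasing 0≤g) Σg≤b
    in k - l , lim-cong
         (λ n → trans (+-congʳ (partialSum-zip f g n))
           (solve 2 (λ x y → x :+ y :- y := x) refl (partialSum f n) (partialSum g n)))
         (lim-minus f+g→k g→l)
    where
    f+g : ℕ → ℝ
    f+g k = f k + g k
    0≤g : ∀ k → 0# ≤ g k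
    0≤g k = ≤-trans (∣x∣≥0 (f k)) (∣f∣≤g k)
    0≤f+g : ∀ k → 0# ≤ f+g k
    0≤f+g k = ≤-transfer (≤-trans (-x≤∣x∣ (f k)) (∣f∣≤g k))
      (solve 2 (λ x y → y :- (:- x) := x :+ y :- :0) refl (f k) (g k))
    Σ[f+g]≤b+b : ∀ n → partialSum f+g n ≤ b + b
    Σ[f+g]≤b+b n = begin
      partialSum f+g n                 ≤⟨ partialSum-mono-≤ (λ k → +-monoˡ-≤ (g k) (≤-trans (x≤∣x∣ (f k)) (∣f∣≤g k))) n ⟩
      partialSum (λ k → g k + g k) n   ≈⟨ partialSum-zip g g n ⟩
      partialSum g n + partialSum g n  ≤⟨ +-mono-≤ (Σg≤b n) (Σg≤b n) ⟩
      b + b                            ∎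

  -- Comparison with a geometric series of ratio 1/2, written without division: by induction the
  -- terms after the first add up to at most 2 f(1) ≤ f(0).
  partialSum-halving : ∀ {f} → (∀ k → f (suc k) + f (suc k) ≤ f k) → (∀ k → 0# ≤ f k) →
                       ∀ n → partialSum f n ≤ f 0 + f 0
  partialSum-halving halving 0≤f zero    = +-nonneg (0≤f 0) (0≤f 0)
  partialSum-halving halving 0≤f (suc n) = +-monoʳ-≤ _
    (≤-trans (partialSum-halving (halving ∘ suc) (0≤f ∘ suc) n) (halving 0))

  fromℕᴿ-* : ∀ m n → fromℕᴿ (m ℕ.* n) ≈ fromℕᴿ m * fromℕᴿ n
  fromℕᴿ-* = SemiringMult.×1-homo-* semiring

  fromℕᴿ-!-pos : ∀ k → 0# < fromℕᴿ (k !)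
  fromℕᴿ-!-pos zero    = fromℕᴿ-pos 0
  fromℕᴿ-!-pos (suc k) = <-respʳ-≈ (sym (fromℕᴿ-* (suc k) (k !))) (*-pos (fromℕᴿ-pos k) (fromℕᴿ-!-pos k))

  invFactorial : ℕ → ℝ
  invFactorial k = fromℕᴿ (k !) ⁻¹

  invFactorial-suc : ∀ k → fromℕᴿ (suc k) * invFactorial (suc k) ≈ invFactorial k
  invFactorial-suc k = *-cancelˡ-≈ (fromℕᴿ-!-pos k) $ begin-equality
    fromℕᴿ (k !) * (fromℕᴿ (suc k) * i)   ≈⟨ solve 3 (λ x y z → x :* (y :* z) := y :* x :* z) refl (fromℕᴿ (k !)) (fromℕᴿ (suc k)) i ⟩
    fromℕᴿ (suc k) * fromℕᴿ (k !) * i     ≈⟨ *-congʳ (fromℕᴿ-* (suc k) (k !)) ⟨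
    fromℕᴿ (suc k !) * i                  ≈⟨ *-inverseʳ _ (>⇒≉0 (fromℕᴿ-!-pos (suc k))) ⟩
    1#                                    ≈⟨ *-inverseʳ _ (>⇒≉0 (fromℕᴿ-!-pos k)) ⟨
    fromℕᴿ (k !) * invFactorial k         ∎
    where i = invFactorial (suc k)

  invFactorial-0 : invFactorial 0 ≈ 1#
  invFactorial-0 = *-cancelˡ-≈ 0<1 $ begin-equality
    1# * i             ≈⟨ solve 1 (λ i → :1 :* i := (:1 :+ :0) :* i) refl i ⟩
    fromℕᴿ (0 !) * i   ≈⟨ *-inverseʳ _ (>⇒≉0 (fromℕᴿ-!-pos 0)) ⟩
    1#                 ≈⟨ *-identityʳ 1# ⟨
    1# * 1#            ∎
    where i = invFactorial 0

  expTermᴿ : ℝ → ℕ → ℝ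
  expTermᴿ x k = invFactorial k * x ^ k

  expTermᴿ-dividedPowers : ∀ x → DividedPowers x (expTermᴿ x)
  expTermᴿ-dividedPowers x = trans (*-identityʳ _) invFactorial-0 , λ k → begin-equality
    fromℕᴿ (suc k) * (invFactorial (suc k) * (x * x ^ k))
      ≈⟨ solve 4 (λ κ i x y → κ :* (i :* (x :* y)) := x :* (κ :* i :* y)) refl
           (fromℕᴿ (suc k)) (invFactorial (suc k)) x (x ^ k) ⟩
    x * (fromℕᴿ (suc k) * invFactorial (suc k) * x ^ k)
      ≈⟨ *-congˡ (*-congʳ (invFactorial-suc k)) ⟩
    x * expTermᴿ x k ∎

  module _ {x} (0≤x : 0# ≤ x) where

    expTermᴿ-nonneg : ∀ k → 0# ≤ expTermᴿ x k
    expTermᴿ-nonneg k = *-nonneg (<⇒≤ (⁻¹-pos (fromℕᴿ-!-pos k))) (^-nonneg 0≤x k)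

    -- From (k+1) tₖ₊₁ = x tₖ: twice the left side is 2x tₖ, which is at most (k+1) tₖ.
    expTermᴿ-halving : ∀ k → x + x ≤ fromℕᴿ (suc k) →
                       expTermᴿ x (suc k) + expTermᴿ x (suc k) ≤ expTermᴿ x k
    expTermᴿ-halving k x+x≤k+1 = *-cancelˡ-≤ (fromℕᴿ-pos k) $ begin
      fromℕᴿ (suc k) * (t + t)                      ≈⟨ distribˡ _ _ _ ⟩
      fromℕᴿ (suc k) * t + fromℕᴿ (suc k) * t       ≈⟨ +-cong (proj₂ (expTermᴿ-dividedPowers x) k) (proj₂ (expTermᴿ-dividedPowers x) k) ⟩
      x * expTermᴿ x k + x * expTermᴿ x k           ≈⟨ solve 2 (λ x y → x :* y :+ x :* y := y :* (x :+ x)) refl x (expTermᴿ x k) ⟩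
      expTermᴿ x k * (x + x)                        ≤⟨ *-monoʳ-≤ (expTermᴿ-nonneg k) x+x≤k+1 ⟩
      expTermᴿ x k * fromℕᴿ (suc k)                 ≈⟨ *-comm _ _ ⟩
      fromℕᴿ (suc k) * expTermᴿ x k                 ∎
      where t = expTermᴿ x (suc k)

    expᴿ-bounded : ∃[ b ] ∀ n → partialSum (expTermᴿ x) n ≤ b
    expᴿ-bounded with archimedean (x + x)
    -- From index K > 2x on the terms at least halve, so the tail adds no more than twice its first
    -- term.
    ... | K , x+x<K = partialSum t K + (t (K ℕ.+ 0) + t (K ℕ.+ 0)) , λ n → begin
      partialSum t n                               ≤⟨ partialSum-increasing expTermᴿ-nonneg n K ⟩
      partialSum t (n ℕ.+ K)                       ≡⟨ ≡.cong (partialSum t) (ℕ.+-comm n K) ⟩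
      partialSum t (K ℕ.+ n)                       ≈⟨ partialSum-+ t K n ⟩
      partialSum t K + partialSum (t ∘ (K ℕ.+_)) n ≤⟨ +-monoʳ-≤ _ (partialSum-halving halving (λ k → expTermᴿ-nonneg (K ℕ.+ k)) n) ⟩
      partialSum t K + (t (K ℕ.+ 0) + t (K ℕ.+ 0)) ∎
      where
      t = expTermᴿ x
      halving : ∀ k → t (K ℕ.+ suc k) + t (K ℕ.+ suc k) ≤ t (K ℕ.+ k)
      halving k = ≡.subst (λ j → t j + t j ≤ t (K ℕ.+ k)) (≡.sym (ℕ.+-suc K k))
        (expTermᴿ-halving (K ℕ.+ k) (≤-trans (<⇒≤ x+x<K) (fromℕᴿ-mono (ℕ.≤-trans (ℕ.m≤m+n K k) (ℕ.n≤1+n _)))))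

    expᴿ-converges : ∃[ l ] ConvergesTo (partialSum (expTermᴿ x)) l
    expᴿ-converges = monotone-convergence (partialSum-increasing expTermᴿ-nonneg) (proj₂ expᴿ-bounded)

-- The ring ℂ, its norm, and majorised products of complex series

module ComplexExponential {c ℓ₁ ℓ₂} (R : CompleteOrderedField c ℓ₁ ℓ₂) where

  open RealComplex R
  open OrderedField R
  open Limits R
  open RingSolver commutativeRing
  open PowerSeries commutativeRing
  open ≤-Reasoning

  -- Built on `ℂ-rawRing` itself, so the solver and the power series lemmas speak of the very
  -- operations that occur in the theorem.
  ℂ-commutativeRing : CommutativeRing c ℓ₁
  ℂ-commutativeRing = record
    { RawRing ℂ-rawRing
    ; isCommutativeRing = record
      { isRing = record
        { +-isAbelianGroup = record
          { isGroup = record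
            { isMonoid = record
              { isSemigroup = record
                { isMagma = record
                  { isEquivalence = record
                    { refl  = refl , refl
                    ; sym   = λ (p , q) → sym p , sym q
                    ; trans = λ (p , q) (r , s) → trans p r , trans q s
                    }
                  ; ∙-cong = λ (p , q) (r , s) → +-cong p r , +-cong q s
                  }
                ; assoc = λ _ _ _ → +-assoc _ _ _ , +-assoc _ _ _
                }
              ; identity = (λ _ → +-identityˡ _ , +-identityˡ _) , (λ _ → +-identityʳ _ , +-identityʳ _)
              }
            ; inverse = (λ _ → -‿inverseˡ _ , -‿inverseˡ _) , (λ _ → -‿inverseʳ _ , -‿inverseʳ _)
            ; ⁻¹-cong = λ (p , q) → -‿cong p , -‿cong q
            }
          ; comm = λ _ _ → +-comm _ _ , +-comm _ _
          }
        ; *-cong = λ (p , q) (r , s) →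
            +-cong (*-cong p r) (-‿cong (*-cong q s)) , +-cong (*-cong p s) (*-cong q r)
        ; *-assoc = λ (a , b) (p , q) (x , y) →
            solve 6 (λ a b p q x y → (a :* p :- b :* q) :* x :- (a :* q :+ b :* p) :* y
                                  := a :* (p :* x :- q :* y) :- b :* (p :* y :+ q :* x)) refl a b p q x y ,
            solve 6 (λ a b p q x y → (a :* p :- b :* q) :* y :+ (a :* q :+ b :* p) :* x
                                  := a :* (p :* y :+ q :* x) :+ b :* (p :* x :- q :* y)) refl a b p q x y
        ; *-identity =
            (λ (x , y) → solve 2 (λ x y → :1 :* x :- :0 :* y := x) refl x y ,
                         solve 2 (λ x y → :1 :* y :+ :0 :* x := y) refl x y) ,
            (λ (x , y) → solve 2 (λ x y → x :* :1 :- y :* :0 := x) refl x y ,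
                         solve 2 (λ x y → x :* :0 :+ y :* :1 := y) refl x y)
        ; distrib =
            (λ (a , b) (p , q) (x , y) →
              solve 6 (λ a b p q x y → a :* (p :+ x) :- b :* (q :+ y)
                                    := a :* p :- b :* q :+ (a :* x :- b :* y)) refl a b p q x y ,
              solve 6 (λ a b p q x y → a :* (q :+ y) :+ b :* (p :+ x)
                                    := a :* q :+ b :* p :+ (a :* y :+ b :* x)) refl a b p q x y) ,
            (λ (a , b) (p , q) (x , y) →
              solve 6 (λ a b p q x y → (p :+ x) :* a :- (q :+ y) :* b
                                    := p :* a :- q :* b :+ (x :* a :- y :* b)) refl a b p q x y ,
              solve 6 (λ a b p q x y → (p :+ x) :* b :+ (q :+ y) :* a
                                    := p :* b :+ q :* a :+ (x :* b :+ y :* a)) refl a b p q x y)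
        }
      ; *-comm = λ (a , b) (p , q) →
          solve 4 (λ a b p q → a :* p :- b :* q := p :* a :- q :* b) refl a b p q ,
          solve 4 (λ a b p q → a :* q :+ b :* p := p :* b :+ q :* a) refl a b p q
      }
    }

  module ℂR = CommutativeRing ℂ-commutativeRing
  module ℂP = PowerSeries ℂ-commutativeRing
  module ℂS = RingSolver ℂ-commutativeRing

  infixl 6 _-ᶜ_
  _-ᶜ_ : ℂ → ℂ → ℂ
  _-ᶜ_ = ℂR._-_

  1ᶜ : ℂ
  1ᶜ = ℂR.1#

  -- The ℓ¹ norm: it needs no square root, and being submultiplicative is enough to majorise series.
  ∥_∥ : ℂ → ℝ
  ∥ z ∥ = ∣ re z ∣ + ∣ im z ∣

  ∥∥-cong : ∀ {z w} → z ≈ᶜ w → ∥ z ∥ ≈ ∥ w ∥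
  ∥∥-cong (p , q) = +-cong (∣∣-cong p) (∣∣-cong q)

  ∥z∥≥0 : ∀ z → 0# ≤ ∥ z ∥
  ∥z∥≥0 (x , y) = +-nonneg (∣x∣≥0 x) (∣x∣≥0 y)

  ∣re∣≤∥∥ : ∀ z → ∣ re z ∣ ≤ ∥ z ∥
  ∣re∣≤∥∥ (x , y) = ≤-respˡ (+-identityʳ _) (+-monoʳ-≤ ∣ x ∣ (∣x∣≥0 y))

  ∣im∣≤∥∥ : ∀ z → ∣ im z ∣ ≤ ∥ z ∥
  ∣im∣≤∥∥ (x , y) = ≤-respˡ (+-identityˡ _) (+-monoˡ-≤ ∣ y ∣ (∣x∣≥0 x))

  ∥ofReal∥ : ∀ {x} → 0# ≤ x → ∥ ofReal x ∥ ≈ x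
  ∥ofReal∥ 0≤x = trans (+-cong (∣x∣≈x 0≤x) (∣x∣≈x ≤-refl)) (+-identityʳ _)

  ∥z+w∥≤∥z∥+∥w∥ : ∀ z w → ∥ z +ᶜ w ∥ ≤ ∥ z ∥ + ∥ w ∥
  ∥z+w∥≤∥z∥+∥w∥ (x , y) (u , v) = begin
    ∣ x + u ∣ + ∣ y + v ∣                ≤⟨ +-mono-≤ (∣x+y∣≤∣x∣+∣y∣ x u) (∣x+y∣≤∣x∣+∣y∣ y v) ⟩
    ∣ x ∣ + ∣ u ∣ + (∣ y ∣ + ∣ v ∣)      ≈⟨ solve 4 (λ a b c d → a :+ b :+ (c :+ d) := a :+ c :+ (b :+ d)) refl (∣ x ∣) (∣ u ∣) (∣ y ∣) (∣ v ∣) ⟩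
    ∣ x ∣ + ∣ y ∣ + (∣ u ∣ + ∣ v ∣)      ∎

  ∥z*w∥≤∥z∥*∥w∥ : ∀ z w → ∥ z *ᶜ w ∥ ≤ ∥ z ∥ * ∥ w ∥
  ∥z*w∥≤∥z∥*∥w∥ (x , y) (u , v) = begin
    ∣ x * u - y * v ∣ + ∣ x * v + y * u ∣
      ≤⟨ +-mono-≤ (∣x-y∣≤∣x∣+∣y∣ (x * u) (y * v)) (∣x+y∣≤∣x∣+∣y∣ (x * v) (y * u)) ⟩
    ∣ x * u ∣ + ∣ y * v ∣ + (∣ x * v ∣ + ∣ y * u ∣)
      ≤⟨ +-mono-≤ (+-mono-≤ (∣x*y∣≤∣x∣*∣y∣ x u) (∣x*y∣≤∣x∣*∣y∣ y v))
                  (+-mono-≤ (∣x*y∣≤∣x∣*∣y∣ x v) (∣x*y∣≤∣x∣*∣y∣ y u)) ⟩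
    ∣ x ∣ * ∣ u ∣ + ∣ y ∣ * ∣ v ∣ + (∣ x ∣ * ∣ v ∣ + ∣ y ∣ * ∣ u ∣)
      ≈⟨ solve 4 (λ x y u v → x :* u :+ y :* v :+ (x :* v :+ y :* u) := (x :+ y) :* (u :+ v)) refl
           (∣ x ∣) (∣ y ∣) (∣ u ∣) (∣ v ∣) ⟩
    (∣ x ∣ + ∣ y ∣) * (∣ u ∣ + ∣ v ∣) ∎

  ∥z^n∥≤∥z∥^n : ∀ z n → ∥ z ^ᶜ n ∥ ≤ ∥ z ∥ ^ n
  ∥z^n∥≤∥z∥^n z zero    = ≈⇒≤ (∥ofReal∥ 0≤1)
  ∥z^n∥≤∥z∥^n z (suc n) = ≤-trans (∥z*w∥≤∥z∥*∥w∥ z (z ^ᶜ n)) (*-monoʳ-≤ (∥z∥≥0 z) (∥z^n∥≤∥z∥^n z n))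

  ∥partialSum∥≤ : ∀ {f g} → (∀ k → ∥ f k ∥ ≤ g k) → ∀ n → ∥ ℂP.partialSum f n ∥ ≤ partialSum g n
  ∥partialSum∥≤         ∥f∥≤g zero    = ≈⇒≤ (∥ofReal∥ ≤-refl)
  ∥partialSum∥≤ {f} {g} ∥f∥≤g (suc n) =
    ≤-trans (∥z+w∥≤∥z∥+∥w∥ (f 0) _) (+-mono-≤ (∥f∥≤g 0) (∥partialSum∥≤ (∥f∥≤g ∘ suc) n))

  partialSum-difference : ∀ {f g} → (∀ k → ∥ f k ∥ ≤ g k) → ∀ {m n} → m ℕ.≤ n →
    ∥ ℂP.partialSum f n -ᶜ ℂP.partialSum f m ∥ ≤ partialSum g n - partialSum g m
  partialSum-difference {f} {g} ∥f∥≤g {m} {n} m≤n =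
    ≡.subst (λ n → ∥ ℂP.partialSum f n -ᶜ ℂP.partialSum f m ∥ ≤ partialSum g n - partialSum g m)
      (ℕ.m+[n∸m]≡n m≤n) (from-m (n ℕ.∸ m))
    where
    from-m : ∀ d → ∥ ℂP.partialSum f (m ℕ.+ d) -ᶜ ℂP.partialSum f m ∥ ≤ partialSum g (m ℕ.+ d) - partialSum g m
    from-m d = begin
      ∥ ℂP.partialSum f (m ℕ.+ d) -ᶜ ℂP.partialSum f m ∥
        ≈⟨ ∥∥-cong (ℂR.trans (ℂR.+-congʳ (ℂP.partialSum-+ f m d))
             (ℂS.solve 2 (λ x y → x ℂS.:+ y ℂS.:- x ℂS.:= y) ℂR.refl (ℂP.partialSum f m) _)) ⟩
      ∥ ℂP.partialSum (f ∘ (m ℕ.+_)) d ∥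
        ≤⟨ ∥partialSum∥≤ (∥f∥≤g ∘ (m ℕ.+_)) d ⟩
      partialSum (g ∘ (m ℕ.+_)) d
        ≈⟨ solve 2 (λ x y → y := x :+ y :- x) refl (partialSum g m) _ ⟩
      partialSum g m + partialSum (g ∘ (m ℕ.+_)) d - partialSum g m
        ≈⟨ +-congʳ (partialSum-+ g m d) ⟨
      partialSum g (m ℕ.+ d) - partialSum g m ∎

  -- The difference consists of the products aᵢ bⱼ in the rectangle but outside the triangle, each
  -- majorised by αᵢ βⱼ. Row i contributes aᵢ times a block of b between two partial sums; `m` is
  -- separate from `n` because peeling off rows shrinks only `n`.
  rectangle-triangle-difference : ∀ {b β} → (∀ k → ∥ b k ∥ ≤ β k) → ∀ {a α} → (∀ k → ∥ a k ∥ ≤ α k) →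
    ∀ {n m} → n ℕ.≤ m →
    ∥ ℂP.partialSum a n *ᶜ ℂP.partialSum b m -ᶜ ℂP.triangleSum a b n ∥
      ≤ partialSum α n * partialSum β m - triangleSum α β n
  rectangle-triangle-difference {b} {β} ∥b∥≤β {a} {α} ∥a∥≤α {zero} {m} n≤m = begin
    ∥ 0ᶜ *ᶜ ℂP.partialSum b m -ᶜ 0ᶜ ∥
      ≈⟨ ∥∥-cong (ℂS.solve 1 (λ x → ℂS.:0 ℂS.:* x ℂS.:- ℂS.:0 ℂS.:= ℂS.:0) ℂR.refl (ℂP.partialSum b m)) ⟩
    ∥ 0ᶜ ∥                             ≈⟨ ∥ofReal∥ ≤-refl ⟩
    0#                                 ≈⟨ solve 1 (λ x → :0 := :0 :* x :- :0) refl (partialSum β m) ⟩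
    0# * partialSum β m - 0#           ∎
  rectangle-triangle-difference {b} {β} ∥b∥≤β {a} {α} ∥a∥≤α {suc n} {m} n<m = begin
    ∥ (a 0 +ᶜ A) *ᶜ Bₘ -ᶜ (a 0 *ᶜ Bₙ +ᶜ T) ∥
      ≈⟨ ∥∥-cong (ℂS.solve 5 (λ x A Bₘ Bₙ T → (x ℂS.:+ A) ℂS.:* Bₘ ℂS.:- (x ℂS.:* Bₙ ℂS.:+ T)
           ℂS.:= x ℂS.:* (Bₘ ℂS.:- Bₙ) ℂS.:+ (A ℂS.:* Bₘ ℂS.:- T)) ℂR.refl (a 0) A Bₘ Bₙ T) ⟩
    ∥ a 0 *ᶜ (Bₘ -ᶜ Bₙ) +ᶜ (A *ᶜ Bₘ -ᶜ T) ∥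
      ≤⟨ ∥z+w∥≤∥z∥+∥w∥ (a 0 *ᶜ (Bₘ -ᶜ Bₙ)) (A *ᶜ Bₘ -ᶜ T) ⟩
    ∥ a 0 *ᶜ (Bₘ -ᶜ Bₙ) ∥ + ∥ A *ᶜ Bₘ -ᶜ T ∥
      ≤⟨ +-mono-≤
           (≤-trans (∥z*w∥≤∥z∥*∥w∥ (a 0) (Bₘ -ᶜ Bₙ))
             (*-mono-≤ (∥z∥≥0 (Bₘ -ᶜ Bₙ)) (∥a∥≤α 0) (partialSum-difference ∥b∥≤β n<m)
               (≤-trans (∥z∥≥0 (a 0)) (∥a∥≤α 0))))
           (rectangle-triangle-difference ∥b∥≤β (∥a∥≤α ∘ suc) (ℕ.<⇒≤ n<m)) ⟩
    α 0 * (βₘ - βₙ) + (A′ * βₘ - T′)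
      ≈⟨ solve 5 (λ x A Bₘ Bₙ T → x :* (Bₘ :- Bₙ) :+ (A :* Bₘ :- T)
           := (x :+ A) :* Bₘ :- (x :* Bₙ :+ T)) refl (α 0) A′ βₘ βₙ T′ ⟩
    (α 0 + A′) * βₘ - (α 0 * βₙ + T′) ∎
    where
    A  = ℂP.partialSum (a ∘ suc) n
    Bₘ = ℂP.partialSum b m
    Bₙ = ℂP.partialSum b (suc n)
    T  = ℂP.triangleSum (a ∘ suc) b n
    A′ = partialSum (α ∘ suc) n
    βₘ = partialSum β m
    βₙ = partialSum β (suc n)
    T′ = triangleSum (α ∘ suc) β n

  triangleSum-nonneg : ∀ {α β} → (∀ k → 0# ≤ α k) → (∀ k → 0# ≤ β k) → ∀ n → 0# ≤ triangleSum α β n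
  triangleSum-nonneg 0≤α 0≤β zero    = ≤-refl
  triangleSum-nonneg 0≤α 0≤β (suc n) =
    +-nonneg (*-nonneg (0≤α 0) (partialSum-nonneg 0≤β (suc n))) (triangleSum-nonneg (0≤α ∘ suc) 0≤β n)

  -- If i < n and j < m then i + j < n + m, and the other terms of the triangle are nonnegative.
  rectangle≤triangle : ∀ {α β} → (∀ k → 0# ≤ α k) → (∀ k → 0# ≤ β k) → ∀ n m →
    partialSum α n * partialSum β m ≤ triangleSum α β (n ℕ.+ m)
  rectangle≤triangle 0≤α 0≤β zero m =
    ≤-respˡ (sym (zeroˡ _)) (triangleSum-nonneg 0≤α 0≤β m)
  rectangle≤triangle {α} {β} 0≤α 0≤β (suc n) m = ≤-respˡ (sym (distribʳ _ _ _)) $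
    +-mono-≤ (*-monoʳ-≤ (0≤α 0) (≡.subst (λ k → partialSum β m ≤ partialSum β k) m+1+n≡1+n+m
               (partialSum-increasing 0≤β m (suc n))))
             (rectangle≤triangle (0≤α ∘ suc) 0≤β n m)
    where
    m+1+n≡1+n+m : m ℕ.+ suc n ≡ suc (n ℕ.+ m)
    m+1+n≡1+n+m = ℕ.+-comm m (suc n)

  ofReal-* : ∀ x z → ofReal x *ᶜ z ≈ᶜ (x * re z , x * im z)
  ofReal-* x (u , v) = solve 3 (λ x u v → x :* u :- :0 :* v := x :* u) refl x u v ,
                       solve 3 (λ x u v → x :* v :+ :0 :* u := x :* v) refl x u v

  embedℕ≈ofReal : ∀ n → ℂP.embedℕ n ≈ᶜ ofReal (fromℕᴿ n)
  embedℕ≈ofReal zero    = refl , refl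
  embedℕ≈ofReal (suc n) = +-congˡ (proj₁ (embedℕ≈ofReal n)) , trans (+-identityˡ _) (proj₂ (embedℕ≈ofReal n))

  -- The cancellation that `dividedPowers-unique` asks for: a natural number acts on ℂ by scaling
  -- both coordinates.
  embedℕ-cancel : ∀ k {u v} → ℂP.embedℕ (suc k) *ᶜ u ≈ᶜ ℂP.embedℕ (suc k) *ᶜ v → u ≈ᶜ v
  embedℕ-cancel k {u} {v} eq = *-cancelˡ-≈ (fromℕᴿ-pos k) (proj₁ scaled) , *-cancelˡ-≈ (fromℕᴿ-pos k) (proj₂ scaled)
    where
    scale : ∀ z → ℂP.embedℕ (suc k) *ᶜ z ≈ᶜ (fromℕᴿ (suc k) * re z , fromℕᴿ (suc k) * im z)
    scale z = ℂR.trans (ℂR.*-congʳ (embedℕ≈ofReal (suc k))) (ofReal-* (fromℕᴿ (suc k)) z)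
    scaled : (fromℕᴿ (suc k) * re u , fromℕᴿ (suc k) * im u) ≈ᶜ (fromℕᴿ (suc k) * re v , fromℕᴿ (suc k) * im v)
    scaled = ℂR.trans (ℂR.sym (scale u)) (ℂR.trans eq (scale v))

  expTerm : ℂ → ℕ → ℂ
  expTerm z k = ofReal (invFactorial k) *ᶜ z ^ᶜ k

  expTerm-dividedPowers : ∀ z → ℂP.DividedPowers z (expTerm z)
  expTerm-dividedPowers z = ℂR.trans (ℂR.*-identityʳ _) (invFactorial-0 , refl) , λ k →
    ℂR.trans (ℂR.*-congʳ (embedℕ≈ofReal (suc k)))
    (ℂR.trans (ℂS.solve 4 (λ κ i x y → κ ℂS.:* (i ℂS.:* (x ℂS.:* y)) ℂS.:= x ℂS.:* (κ ℂS.:* i ℂS.:* y)) ℂR.refl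
                 (ofReal (fromℕᴿ (suc k))) (ofReal (invFactorial (suc k))) z (z ^ᶜ k))
              (ℂR.*-congˡ (ℂR.*-congʳ (ofReal-invFactorial-suc k))))
    where
    ofReal-invFactorial-suc : ∀ k → ofReal (fromℕᴿ (suc k)) *ᶜ ofReal (invFactorial (suc k)) ≈ᶜ ofReal (invFactorial k)
    ofReal-invFactorial-suc k = ℂR.trans (ofReal-* _ _) (invFactorial-suc k , zeroʳ _)

  ∥expTerm∥≤ : ∀ z k → ∥ expTerm z k ∥ ≤ expTermᴿ ∥ z ∥ k
  ∥expTerm∥≤ z k = begin
    ∥ ofReal i *ᶜ z ^ᶜ k ∥      ≤⟨ ∥z*w∥≤∥z∥*∥w∥ (ofReal i) (z ^ᶜ k) ⟩
    ∥ ofReal i ∥ * ∥ z ^ᶜ k ∥   ≈⟨ *-congʳ (∥ofReal∥ 0≤i) ⟩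
    i * ∥ z ^ᶜ k ∥              ≤⟨ *-monoʳ-≤ 0≤i (∥z^n∥≤∥z∥^n z k) ⟩
    i * ∥ z ∥ ^ k               ∎
    where
    i = invFactorial k
    0≤i = <⇒≤ (⁻¹-pos (fromℕᴿ-!-pos k))

-- The exponential: existence, addition formula, behaviour near 0, conjugation

module Exponential {c ℓ₁ ℓ₂} (R : CompleteOrderedField c ℓ₁ ℓ₂) where

  open RealComplex R
  open OrderedField R
  open Limits R
  open ComplexExponential R
  open RingSolver commutativeRing
  open PowerSeries commutativeRing
  open ≤-Reasoning

  ConvergesToᶜ : (ℕ → ℂ) → ℂ → Set _
  ConvergesToᶜ f w = ConvergesTo (re ∘ f) (re w) × ConvergesTo (im ∘ f) (im w)

  sumᶜ≡partialSum : ∀ (f : ℕ → ℂ) n → sumᶜ {n} (f ∘ toℕ) ≡ ℂP.partialSum f n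
  sumᶜ≡partialSum f zero    = ≡.refl
  sumᶜ≡partialSum f (suc n) = ≡.cong (f 0 +ᶜ_) (sumᶜ≡partialSum (f ∘ suc) n)

  isExp⇒limit : ∀ {z w} → IsExp z w → ConvergesToᶜ (ℂP.partialSum (expTerm z)) w
  isExp⇒limit {z} (p , q) =
    lim-cong (λ n → reflexive (≡.cong re (sumᶜ≡partialSum (expTerm z) n))) p ,
    lim-cong (λ n → reflexive (≡.cong im (sumᶜ≡partialSum (expTerm z) n))) q

  limit⇒isExp : ∀ {z w} → ConvergesToᶜ (ℂP.partialSum (expTerm z)) w → IsExp z w
  limit⇒isExp {z} (p , q) =
    lim-cong (λ n → reflexive (≡.sym (≡.cong re (sumᶜ≡partialSum (expTerm z) n)))) p ,
    lim-cong (λ n → reflexive (≡.sym (≡.cong im (sumᶜ≡partialSum (expTerm z) n)))) q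

  isExp-unique : ∀ {z u v} → IsExp z u → IsExp z v → u ≈ᶜ v
  isExp-unique (p , q) (p′ , q′) = lim-unique p p′ , lim-unique q q′

  expTerm-cong : ∀ {z w} → z ≈ᶜ w → ∀ k → expTerm z k ≈ᶜ expTerm w k
  expTerm-cong {z} {w} z≈w k = ℂR.*-congˡ (^-cong k)
    where
    ^-cong : ∀ k → z ^ᶜ k ≈ᶜ w ^ᶜ k
    ^-cong zero    = ℂR.refl
    ^-cong (suc k) = ℂR.*-cong z≈w (^-cong k)

  isExp-cong : ∀ {z w u} → z ≈ᶜ w → IsExp z u → IsExp w u
  isExp-cong {z} {w} z≈w e =
    limit⇒isExp (lim-cong (λ n → proj₁ (terms n)) (proj₁ (isExp⇒limit e)) ,
                 lim-cong (λ n → proj₂ (terms n)) (proj₂ (isExp⇒limit e)))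
    where
    terms : ∀ n → ℂP.partialSum (expTerm z) n ≈ᶜ ℂP.partialSum (expTerm w) n
    terms = ℂP.partialSum-cong (expTerm-cong z≈w)

  re-partialSum : ∀ f n → partialSum (re ∘ f) n ≡ re (ℂP.partialSum f n)
  re-partialSum f zero    = ≡.refl
  re-partialSum f (suc n) = ≡.cong (λ x → re (f 0) + x) (re-partialSum (f ∘ suc) n)

  im-partialSum : ∀ f n → partialSum (im ∘ f) n ≡ im (ℂP.partialSum f n)
  im-partialSum f zero    = ≡.refl
  im-partialSum f (suc n) = ≡.cong (λ x → im (f 0) + x) (im-partialSum (f ∘ suc) n)

  abstract
    -- Each coordinate of the series is majorised by the real series at ∥z∥. Being abstract, the
    -- limit is known only through `IsExp`.
    exp-exists : ∀ z → ∃[ w ] IsExp z w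
    exp-exists z =
      let b , Σ≤b = expᴿ-bounded (∥z∥≥0 z)
          x , p = comparison-test (λ k → ≤-trans (∣re∣≤∥∥ (expTerm z k)) (∥expTerm∥≤ z k)) Σ≤b
          y , q = comparison-test (λ k → ≤-trans (∣im∣≤∥∥ (expTerm z k)) (∥expTerm∥≤ z k)) Σ≤b
      in (x , y) , limit⇒isExp (lim-cong (λ n → reflexive (re-partialSum (expTerm z) n)) p ,
                                lim-cong (λ n → reflexive (im-partialSum (expTerm z) n)) q)

  module _ (z w : ℂ) where

    private
      α = expTermᴿ ∥ z ∥
      β = expTermᴿ ∥ w ∥
      Aₙ = ℂP.partialSum (expTerm z)
      Bₙ = ℂP.partialSum (expTerm w)
      Cₙ = ℂP.partialSum (expTerm (z +ᶜ w))

    -- An exact identity for every n: the antidiagonal sums are the divided powers of z + w, so only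
    -- the gap between square and triangle has to be estimated.
    triangleSum-expTerm : ∀ n → ℂP.triangleSum (expTerm z) (expTerm w) n ≈ᶜ Cₙ n
    triangleSum-expTerm n = ℂR.trans (ℂP.triangleSum≈partialSum-conv _ _ n)
      (ℂP.partialSum-cong (ℂP.dividedPowers-unique embedℕ-cancel
        (ℂP.conv-dividedPowers (expTerm-dividedPowers z) (expTerm-dividedPowers w))
        (expTerm-dividedPowers (z +ᶜ w))) n)

    triangleSum-expTermᴿ : ∀ n → triangleSum α β n ≈ partialSum (expTermᴿ ((∥ z ∥) + (∥ w ∥))) n
    triangleSum-expTermᴿ n = trans (triangleSum≈partialSum-conv _ _ n)
      (partialSum-cong (dividedPowers-unique (λ k → *-cancelˡ-≈ (fromℕᴿ-pos k))
        (conv-dividedPowers (expTermᴿ-dividedPowers ∥ z ∥) (expTermᴿ-dividedPowers ∥ w ∥))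
        (expTermᴿ-dividedPowers ((∥ z ∥) + (∥ w ∥)))) n)

    -- The defect is majorised by the same defect of the real series at ∥z∥ and ∥w∥. There the
    -- square lies inside the triangle of size 2n, and both triangles are partial sums of a single
    -- convergent series.
    cauchy-defect : ∀ n → ∥ Aₙ n *ᶜ Bₙ n -ᶜ Cₙ n ∥ ≤
      partialSum (expTermᴿ ((∥ z ∥) + (∥ w ∥))) (n ℕ.+ n) - partialSum (expTermᴿ ((∥ z ∥) + (∥ w ∥))) n
    cauchy-defect n = begin
      ∥ Aₙ n *ᶜ Bₙ n -ᶜ Cₙ n ∥
        ≈⟨ ∥∥-cong (ℂR.+-congˡ {Aₙ n *ᶜ Bₙ n} (ℂR.-‿cong (triangleSum-expTerm n))) ⟨
      ∥ Aₙ n *ᶜ Bₙ n -ᶜ ℂP.triangleSum (expTerm z) (expTerm w) n ∥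
        ≤⟨ rectangle-triangle-difference (∥expTerm∥≤ w) (∥expTerm∥≤ z) (ℕ.≤-refl {n}) ⟩
      partialSum α n * partialSum β n - triangleSum α β n
        ≤⟨ +-monoˡ-≤ _ (rectangle≤triangle (expTermᴿ-nonneg (∥z∥≥0 z)) (expTermᴿ-nonneg (∥z∥≥0 w)) n n) ⟩
      triangleSum α β (n ℕ.+ n) - triangleSum α β n
        ≈⟨ +-cong (triangleSum-expTermᴿ (n ℕ.+ n)) (-‿cong (triangleSum-expTermᴿ n)) ⟩
      partialSum (expTermᴿ ((∥ z ∥) + (∥ w ∥))) (n ℕ.+ n) - partialSum (expTermᴿ ((∥ z ∥) + (∥ w ∥))) n ∎

    cauchy-defect→0 : ConvergesTo (λ n → re (Aₙ n *ᶜ Bₙ n -ᶜ Cₙ n)) 0# ×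
                      ConvergesTo (λ n → im (Aₙ n *ᶜ Bₙ n -ᶜ Cₙ n)) 0#
    cauchy-defect→0 =
      lim-squeeze (λ n → ≤-trans (∣re∣≤∥∥ (Aₙ n *ᶜ Bₙ n -ᶜ Cₙ n)) (cauchy-defect n)) bound→0 ,
      lim-squeeze (λ n → ≤-trans (∣im∣≤∥∥ (Aₙ n *ᶜ Bₙ n -ᶜ Cₙ n)) (cauchy-defect n)) bound→0
      where
      bound→0 : ConvergesTo (λ n → partialSum (expTermᴿ ((∥ z ∥) + (∥ w ∥))) (n ℕ.+ n)
                                   - partialSum (expTermᴿ ((∥ z ∥) + (∥ w ∥))) n) 0#
      bound→0 = let l , s→l = expᴿ-converges (+-nonneg (∥z∥≥0 z) (∥z∥≥0 w)) in
        lim-congʳ (-‿inverseʳ l) (lim-minus (lim-double s→l) s→l)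

    -- `Cₙ` is the product of the partial sums minus the defect; the product tends to u v and the
    -- defect to 0.
    isExp-+ : ∀ {u v} → IsExp z u → IsExp w v → IsExp (z +ᶜ w) (u *ᶜ v)
    isExp-+ {u} {v} ez ew =
      let p , q = isExp⇒limit ez
          r , s = isExp⇒limit ew
          d , e = cauchy-defect→0
      in limit⇒isExp
        ( lim-cong (λ n → cancel (re (Aₙ n *ᶜ Bₙ n)) (re (Cₙ n)))
            (lim-congʳ (x-0≈x _) (lim-minus (lim-minus (lim-* p r) (lim-* q s)) d))
        , lim-cong (λ n → cancel (im (Aₙ n *ᶜ Bₙ n)) (im (Cₙ n)))
            (lim-congʳ (x-0≈x _) (lim-minus (lim-+ (lim-* p s) (lim-* q r)) e)))
      where
      cancel : ∀ x y → x - (x - y) ≈ y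
      cancel = solve 2 (λ x y → x :- (x :- y) := y) refl
      x-0≈x : ∀ x → x - 0# ≈ x
      x-0≈x = solve 1 (λ x → x :- :0 := x) refl

  -- Two uses of the recurrence replace computing the inverse of 2!. This gives the constant 1 in
  -- the quadratic remainder bound.
  expTermᴿ-2 : ∀ x → expTermᴿ x 2 + expTermᴿ x 2 ≈ x * x
  expTermᴿ-2 x = let t₀ , ∂t = expTermᴿ-dividedPowers x in begin-equality
    expTermᴿ x 2 + expTermᴿ x 2
      ≈⟨ solve 1 (λ t → t :+ t := (:1 :+ (:1 :+ :0)) :* t) refl (expTermᴿ x 2) ⟩
    fromℕᴿ 2 * expTermᴿ x 2           ≈⟨ ∂t 1 ⟩
    x * expTermᴿ x 1
      ≈⟨ *-congˡ (solve 1 (λ t → t := (:1 :+ :0) :* t) refl (expTermᴿ x 1)) ⟩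
    x * (fromℕᴿ 1 * expTermᴿ x 1)     ≈⟨ *-congˡ (∂t 0) ⟩
    x * (x * expTermᴿ x 0)            ≈⟨ *-congˡ (*-congˡ t₀) ⟩
    x * (x * 1#)                      ≈⟨ *-congˡ (*-identityʳ x) ⟩
    x * x                             ∎

  module _ {z : ℂ} (∥z∥≤1 : ∥ z ∥ ≤ 1#) where

    private
      Eₙ = ℂP.partialSum (expTerm z)
      t = expTermᴿ (∥ z ∥)

    -- As ∥z∥ ≤ 1, the majorants from degree 2 on at least halve at each step, so their sum is at
    -- most twice ∥z∥²/2.
    exp-remainder : ∀ n → 2 ℕ.≤ n → ∥ Eₙ n -ᶜ (1ᶜ +ᶜ z) ∥ ≤ (∥ z ∥) * (∥ z ∥)
    exp-remainder (suc (suc n)) (ℕ.s≤s (ℕ.s≤s _)) = begin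
      ∥ expTerm z 0 +ᶜ (expTerm z 1 +ᶜ rest) -ᶜ (1ᶜ +ᶜ z) ∥
        ≈⟨ ∥∥-cong (ℂR.trans (ℂR.+-congʳ (ℂR.+-cong (proj₁ dp) (ℂR.+-congʳ expTerm-1)))
             (ℂS.solve 2 (λ z r → ℂS.:1 ℂS.:+ (z ℂS.:+ r) ℂS.:- (ℂS.:1 ℂS.:+ z) ℂS.:= r) ℂR.refl z rest)) ⟩
      ∥ rest ∥
        ≤⟨ ∥partialSum∥≤ (λ k → ∥expTerm∥≤ z (suc (suc k))) n ⟩
      partialSum (t ∘ suc ∘ suc) n
        ≤⟨ partialSum-halving (λ k → expTermᴿ-halving (∥z∥≥0 z) (suc (suc k))
             (≤-trans (+-mono-≤ ∥z∥≤1 ∥z∥≤1) (≤-trans (≈⇒≤ (+-congˡ (sym (+-identityʳ 1#))))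
                (fromℕᴿ-mono {2} {suc (suc (suc k))} (ℕ.s≤s (ℕ.s≤s ℕ.z≤n))))))
             (λ k → expTermᴿ-nonneg (∥z∥≥0 z) (suc (suc k))) n ⟩
      t 2 + t 2
        ≈⟨ expTermᴿ-2 (∥ z ∥) ⟩
      (∥ z ∥) * (∥ z ∥) ∎
      where
      rest = ℂP.partialSum (expTerm z ∘ suc ∘ suc) n
      dp = expTerm-dividedPowers z
      expTerm-1 : expTerm z 1 ≈ᶜ z
      expTerm-1 = ℂR.trans (ℂS.solve 1 (λ t → t ℂS.:= (ℂS.:1 ℂS.:+ ℂS.:0) ℂS.:* t) ℂR.refl (expTerm z 1))
        (ℂR.trans (proj₂ dp 0) (ℂR.trans (ℂR.*-congˡ (proj₁ dp)) (ℂR.*-identityʳ z)))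

    exp-near-0 : ∀ {e} → IsExp z e →
      ∣ re e - (1# + re z) ∣ ≤ (∥ z ∥) * (∥ z ∥) × ∣ im e - (0# + im z) ∣ ≤ (∥ z ∥) * (∥ z ∥)
    exp-near-0 ez = let p , q = isExp⇒limit ez in
      lim-∣∣-≤ 2 (λ n 2≤n → ≤-trans (∣re∣≤∥∥ (Eₙ n -ᶜ (1ᶜ +ᶜ z))) (exp-remainder n 2≤n)) (lim-minus p (lim-const _)) ,
      lim-∣∣-≤ 2 (λ n 2≤n → ≤-trans (∣im∣≤∥∥ (Eₙ n -ᶜ (1ᶜ +ᶜ z))) (exp-remainder n 2≤n)) (lim-minus q (lim-const _))

  conj : ℂ → ℂ
  conj z = re z , - im z

  conj-+ : ∀ z w → conj (z +ᶜ w) ≈ᶜ conj z +ᶜ conj w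
  conj-+ (x , y) (u , v) = refl , solve 2 (λ y v → :- (y :+ v) := :- y :- v) refl y v

  conj-* : ∀ z w → conj (z *ᶜ w) ≈ᶜ conj z *ᶜ conj w
  conj-* (x , y) (u , v) =
    solve 4 (λ x y u v → x :* u :- y :* v := x :* u :- (:- y) :* (:- v)) refl x y u v ,
    solve 4 (λ x y u v → :- (x :* v :+ y :* u) := x :* (:- v) :+ (:- y) :* u) refl x y u v

  conj-ofReal : ∀ x → conj (ofReal x) ≈ᶜ ofReal x
  conj-ofReal x = refl , solve 0 (:- :0 := :0) refl

  conj-^ : ∀ z n → conj (z ^ᶜ n) ≈ᶜ conj z ^ᶜ n
  conj-^ z zero    = conj-ofReal 1#
  conj-^ z (suc n) = ℂR.trans (conj-* z (z ^ᶜ n)) (ℂR.*-congˡ (conj-^ z n))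

  conj-partialSum : ∀ f n → conj (ℂP.partialSum f n) ≈ᶜ ℂP.partialSum (conj ∘ f) n
  conj-partialSum f zero    = conj-ofReal 0#
  conj-partialSum f (suc n) = ℂR.trans (conj-+ (f 0) _) (ℂR.+-congˡ (conj-partialSum (f ∘ suc) n))

  -- The series has real coefficients, so conjugation passes through its partial sums. It reduces φ
  -- < 0 to -φ > 0.
  isExp-conj : ∀ {z e} → IsExp z e → IsExp (conj z) (conj e)
  isExp-conj {z} ez = let p , q = isExp⇒limit ez in limit⇒isExp
    ( lim-cong (λ n → proj₁ (conjugate n)) p
    , lim-cong (λ n → proj₂ (conjugate n)) (lim-neg q))
    where
    conjugate : ∀ n → conj (ℂP.partialSum (expTerm z) n) ≈ᶜ ℂP.partialSum (expTerm (conj z)) n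
    conjugate n = ℂR.trans (conj-partialSum (expTerm z) n) (ℂP.partialSum-cong
      (λ k → ℂR.trans (conj-* (ofReal (invFactorial k)) (z ^ᶜ k)) (ℂR.*-cong (conj-ofReal _) (conj-^ z k))) n)

-- Local Lipschitz continuity and the intermediate value theorem

module Continuity {c ℓ₁ ℓ₂} (R : CompleteOrderedField c ℓ₁ ℓ₂) where

  open RealComplex R
  open OrderedField R
  open RingSolver commutativeRing
  open ≤-Reasoning

  -- Continuity with an explicit modulus. The radius 1 is the range in which the quadratic remainder
  -- bound of the exponential holds.
  LocallyLipschitz : (ℝ → ℝ) → Set _
  LocallyLipschitz g = ∀ x → ∃[ K ] 0# ≤ K × (∀ y → ∣ y - x ∣ ≤ 1# → ∣ g y - g x ∣ ≤ K * ∣ y - x ∣)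

  neg-locallyLipschitz : ∀ {g} → LocallyLipschitz g → LocallyLipschitz (λ x → - g x)
  neg-locallyLipschitz {g} lip x = let K , 0≤K , bound = lip x in
    K , 0≤K , λ y close → ≤-trans (≤-respˡ (∣∣-cong (solve 2 (λ a b → :- (a :- b) := :- a :- (:- b)) refl (g y) (g x)))
                                     (∣-x∣≤∣x∣ (g y - g x)))
                                   (bound y close)

  ∣x-y∣≤ : ∀ {x y δ} → x ≤ y → y ≤ x + δ → ∣ y - x ∣ ≤ δ
  ∣x-y∣≤ {x} {y} {δ} x≤y y≤x+δ = ∣∣-lub
    (≤-transfer y≤x+δ (solve 3 (λ x y d → x :+ d :- y := d :- (y :- x)) refl x y δ))
    (≤-trans (≤-transfer x≤y (solve 2 (λ x y → y :- x := :0 :- (:- (y :- x))) refl x y))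
      (≤-transfer (≤-trans x≤y y≤x+δ) (solve 2 (λ x d → x :+ d :- x := d :- :0) refl x δ)))

  module _ {g} (lip : LocallyLipschitz g) where

    -- With δ the smaller of 1 and g(x)/(1+K), the change of g is at most K δ < (1+K) δ ≤ g(x). The
    -- added 1 gives strictness and covers K = 0.
    positive-near : ∀ {x} → 0# < g x → ∃[ δ ] 0# < δ × (∀ y → ∣ y - x ∣ ≤ δ → 0# < g y)
    positive-near {x} 0<gx =
      let K , 0≤K , bound = lip x
          0<1+K = <-≤-trans 0<1 (≤-respˡ (+-identityʳ 1#) (+-monoʳ-≤ 1# 0≤K))
          δ , 0<δ , δ≤1 , δ≤gx/[1+K] = common-lower-bound 0<1 (/-pos 0<gx 0<1+K)
      in δ , 0<δ , λ y close → <-transfer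
        (begin-strict
          - (g y - g x)          ≤⟨ -x≤∣x∣ (g y - g x) ⟩
          ∣ g y - g x ∣          ≤⟨ bound y (≤-trans close δ≤1) ⟩
          K * ∣ y - x ∣          ≤⟨ *-monoʳ-≤ 0≤K close ⟩
          K * δ                  ≈⟨ +-identityˡ _ ⟨
          0# + K * δ             <⟨ +-monoˡ-< (K * δ) 0<δ ⟩
          δ + K * δ              ≈⟨ solve 2 (λ k d → d :+ k :* d := (:1 :+ k) :* d) refl K δ ⟩
          (1# + K) * δ           ≤⟨ *-monoʳ-≤ (<⇒≤ 0<1+K) δ≤gx/[1+K] ⟩
          (1# + K) * (g x / (1# + K)) ≈⟨ x*[y/x]≈y 0<1+K (g x) ⟩
          g x                    ∎)
        (solve 2 (λ a b → b :- (:- (a :- b)) := a :- :0) refl (g y) (g x))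

    -- `g` is a bare function that is not assumed to respect `≈`; for its sign this follows from
    -- continuity, as y is within every δ of x.
    positive-resp : ∀ {x y} → x ≈ y → 0# < g x → 0# < g y
    positive-resp {x} {y} x≈y 0<gx = let δ , 0<δ , near = positive-near 0<gx in
      near y (∣x-y∣≤ (≈⇒≤ x≈y) (≤-trans (≈⇒≤ (trans (sym x≈y) (sym (+-identityʳ x)))) (+-monoʳ-≤ x (<⇒≤ 0<δ))))

  neg-pos : ∀ {x} → x < 0# → 0# < - x
  neg-pos {x} x<0 = <-transfer x<0 (solve 1 (λ x → :0 :- x := :- x :- :0) refl x)

  pos-neg : ∀ {x} → 0# < - x → x < 0#
  pos-neg {x} p = <-transfer p (solve 1 (λ x → :- x :- :0 := :0 :- x) refl x)

  -- The zero is the supremum s of the points up to b at which g is positive. A positive value at s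
  -- would persist to the right of s, a negative one to the left, and each contradicts one half of
  -- `IsSupremum`.
  intermediate-zero : ∀ {g} → LocallyLipschitz g → ∀ {a b} → a < b → 0# < g a → g b < 0# →
                      ∃[ x ] a < x × x < b × g x ≈ 0#
  intermediate-zero {g} lip {a} {b} a<b 0<ga gb<0 =
    let s , isSup = complete Pos (a , lift (<⇒≤ a<b , 0<ga)) (b , λ { y (lift (y≤b , _)) → y≤b })
    in s , a<s isSup , s<b isSup , gs≈0 isSup
    where
    Pos : ℝ → Set (c ⊔ ℓ₁ ⊔ ℓ₂)
    Pos y = Lift c (y ≤ b × 0# < g y)
    module _ {s} (isSup : IsSupremum Pos s) where

      private
        upper = proj₁ isSup
        close = proj₂ isSup

      a≤s : a ≤ s
      a≤s = upper a (lift (<⇒≤ a<b , 0<ga))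

      s≤b : s ≤ b
      s≤b = ≮⇒≥ λ b<s → not-beyond (close b b<s)
        where
        not-beyond : ¬ (∃[ y ] Pos y × b < y)
        not-beyond (y , lift (y≤b , _) , b<y) = <⇒≱ b<y y≤b

      gs≯0 : ¬ (0# < g s)
      gs≯0 0<gs =
        let δ , 0<δ , near = positive-near lip 0<gs
            s<b = ≤∧≉⇒< s≤b (λ s≈b → asym gb<0 (positive-resp lip s≈b 0<gs))
            -- η ≤ δ keeps g positive at s + η and η ≤ b - s keeps s + η up to b, so s + η is a
            -- point of `Pos` above s.
            η , 0<η , η≤δ , η≤b-s = common-lower-bound 0<δ (<⇒0<- s<b)
        in beyond near 0<η η≤δ η≤b-s
        where
        beyond : ∀ {δ η} → (∀ y → ∣ y - s ∣ ≤ δ → 0# < g y) → 0# < η → η ≤ δ → ¬ (η ≤ b - s)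
        beyond {δ} {η} near 0<η η≤δ η≤b-s =
          <⇒≱ s<s+η (upper (s + η) (lift (s+η≤b , near (s + η) (∣x-y∣≤ (<⇒≤ s<s+η) (+-monoʳ-≤ s η≤δ)))))
          where
          s<s+η : s < s + η
          s<s+η = <-respˡ-≈ (+-identityʳ s) (+-monoʳ-< s 0<η)
          s+η≤b : s + η ≤ b
          s+η≤b = ≤-transfer η≤b-s (solve 3 (λ b s e → b :- s :- e := b :- (s :+ e)) refl b s η)

      gs≮0 : ¬ (g s < 0#)
      gs≮0 gs<0 =
        let δ , 0<δ , near = positive-near (neg-locallyLipschitz lip) (neg-pos gs<0)
        -- Some point of `Pos` lies in (s - δ, s], where g is negative.
        in not-close near (close (s - δ) (<-transfer 0<δ (solve 2 (λ s d → d :- :0 := s :- (s :- d)) refl s δ)))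
        where
        not-close : ∀ {δ} → (∀ y → ∣ y - s ∣ ≤ δ → 0# < - g y) → ¬ (∃[ y ] Pos y × s - δ < y)
        not-close {δ} near (y , lift (y≤b , 0<gy) , s-δ<y) =
          asym 0<gy (pos-neg (near y (≤-trans
            (≤-respˡ (∣∣-cong (solve 2 (λ s y → :- (s :- y) := y :- s) refl s y)) (∣-x∣≤∣x∣ (s - y)))
            (∣x-y∣≤ (upper y (lift (y≤b , 0<gy))) (≤-transfer (<⇒≤ s-δ<y)
              (solve 3 (λ s d y → y :- (s :- d) := y :+ d :- s) refl s δ y))))))

      gs≈0 : g s ≈ 0#
      gs≈0 = ≤-antisym (≮⇒≥ gs≯0) (≮⇒≥ gs≮0)

      a<s : a < s
      a<s = ≤∧≉⇒< a≤s (λ a≈s → irrefl (sym gs≈0) (positive-resp lip a≈s 0<ga))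

      s<b : s < b
      s<b = ≤∧≉⇒< s≤b (λ s≈b → irrefl gs≈0
        (pos-neg (positive-resp (neg-locallyLipschitz lip) (sym s≈b) (neg-pos gb<0))))

-- The sine function and the powers of e^(iφ)

module Sine {c ℓ₁ ℓ₂} (R : CompleteOrderedField c ℓ₁ ℓ₂) where

  open RealComplex R
  open OrderedField R
  open Limits R
  open ComplexExponential R
  open Exponential R
  open Continuity R
  open RingSolver commutativeRing
  open ≤-Reasoning

  ∥i·∥ : ∀ x → ∥ i· x ∥ ≈ ∣ x ∣
  ∥i·∥ x = trans (+-congʳ (∣x∣≈x ≤-refl)) (+-identityˡ _)

  i·-+ : ∀ x h → i· x +ᶜ i· h ≈ᶜ i· (x + h)
  i·-+ x h = +-identityˡ 0# , refl

  module _ {h d} (∣h∣≤1 : ∣ h ∣ ≤ 1#) (exp-h : IsExp (i· h) d) where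

    private
      near = exp-near-0 (≤-respˡ (sym (∥i·∥ h)) ∣h∣≤1) exp-h

    cos-near-0 : ∣ re d - 1# ∣ ≤ ∣ h ∣ * ∣ h ∣
    cos-near-0 = begin
      ∣ re d - 1# ∣           ≈⟨ ∣∣-cong (+-congˡ (-‿cong (+-identityʳ 1#))) ⟨
      ∣ re d - (1# + 0#) ∣    ≤⟨ proj₁ near ⟩
      (∥ i· h ∥) * (∥ i· h ∥) ≈⟨ *-cong (∥i·∥ h) (∥i·∥ h) ⟩
      ∣ h ∣ * ∣ h ∣           ∎

    sin-near-0 : ∣ im d - h ∣ ≤ ∣ h ∣ * ∣ h ∣
    sin-near-0 = begin
      ∣ im d - h ∣            ≈⟨ ∣∣-cong (+-congˡ (-‿cong (+-identityˡ h))) ⟨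
      ∣ im d - (0# + h) ∣     ≤⟨ proj₂ near ⟩
      (∥ i· h ∥) * (∥ i· h ∥) ≈⟨ *-cong (∥i·∥ h) (∥i·∥ h) ⟩
      ∣ h ∣ * ∣ h ∣           ∎

    -- For e = x + iy the increment is x h + x (sin h - h) + y (cos h - 1). Since |h|² ≤ |h|, each
    -- of the three terms is linear in |h|.
    sin-step : ∀ e → ∣ im (e *ᶜ d) - im e ∣ ≤ ((∥ e ∥) + (∥ e ∥)) * ∣ h ∣
    sin-step (x , y) = begin
      ∣ x * im d + y * re d - y ∣
        ≈⟨ ∣∣-cong (solve 5 (λ x y p q h → x :* q :+ y :* p :- y
             := x :* h :+ (x :* (q :- h) :+ y :* (p :- :1))) refl x y (re d) (im d) h) ⟩
      ∣ x * h + (x * (im d - h) + y * (re d - 1#)) ∣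
        ≤⟨ ≤-trans (∣x+y∣≤∣x∣+∣y∣ (x * h) _) (+-monoʳ-≤ _ (∣x+y∣≤∣x∣+∣y∣ (x * (im d - h)) (y * (re d - 1#)))) ⟩
      ∣ x * h ∣ + (∣ x * (im d - h) ∣ + ∣ y * (re d - 1#) ∣)
        ≤⟨ +-mono-≤ (mul x ≤-refl) (+-mono-≤ (mul x (≤-trans sin-near-0 h²≤h)) (mul y (≤-trans cos-near-0 h²≤h))) ⟩
      ∣ x ∣ * ∣ h ∣ + (∣ x ∣ * ∣ h ∣ + ∣ y ∣ * ∣ h ∣)
        ≤⟨ ≤-transfer (*-nonneg (∣x∣≥0 y) (∣x∣≥0 h))
             (solve 3 (λ x y h → y :* h :- :0
               := (x :+ y :+ (x :+ y)) :* h :- (x :* h :+ (x :* h :+ y :* h))) refl (∣ x ∣) (∣ y ∣) (∣ h ∣)) ⟩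
      (∣ x ∣ + ∣ y ∣ + (∣ x ∣ + ∣ y ∣)) * ∣ h ∣ ∎
      where
      h²≤h : ∣ h ∣ * ∣ h ∣ ≤ ∣ h ∣
      h²≤h = ≤-respʳ (*-identityʳ _) (*-monoʳ-≤ (∣x∣≥0 h) ∣h∣≤1)
      mul : ∀ u {v} → ∣ v ∣ ≤ ∣ h ∣ → ∣ u * v ∣ ≤ ∣ u ∣ * ∣ h ∣
      mul u {v} p = ≤-trans (∣x*y∣≤∣x∣*∣y∣ u v) (*-monoʳ-≤ (∣x∣≥0 u) p)

  exp[i_] : ℝ → ℂ
  exp[i x ] = proj₁ (exp-exists (i· x))

  isExp-exp[i_] : ∀ x → IsExp (i· x) exp[i x ]
  isExp-exp[i x ] = proj₂ (exp-exists (i· x))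

  sin : ℝ → ℝ
  sin x = im exp[i x ]

  sin-unique : ∀ {x e} → IsExp (i· x) e → sin x ≈ im e
  sin-unique {x} exp-x = proj₂ (isExp-unique isExp-exp[i x ] exp-x)

  -- Write e^(iy) = e^(ix) e^(ih) with h = y - x. The constant 2∥e^(ix)∥ may depend on x, so the
  -- modulus of e^(ix) need not be bounded first.
  sin-locallyLipschitz : LocallyLipschitz sin
  sin-locallyLipschitz x = (∥ e ∥) + (∥ e ∥) , +-nonneg (∥z∥≥0 e) (∥z∥≥0 e) , λ y close →
    let h = y - x in
    ≤-respˡ (∣∣-cong (+-congʳ (sym (sin-unique
              (isExp-cong (ℂR.trans (i·-+ x h) (refl , solve 2 (λ x y → x :+ (y :- x) := y) refl x y))
                (isExp-+ (i· x) (i· h) isExp-exp[i x ] isExp-exp[i h ]))))))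
            (sin-step close isExp-exp[i h ] e)
    where e = exp[i x ]

  sin-pos-near-0 : ∀ {x} → 0# < x → x < 1# → 0# < sin x
  sin-pos-near-0 {x} 0<x x<1 = <-transfer
    (begin-strict
      - (sin x - x)     ≤⟨ -x≤∣x∣ (sin x - x) ⟩
      ∣ sin x - x ∣     ≤⟨ sin-near-0 (≤-respˡ (sym ∣x∣≈x′) (<⇒≤ x<1)) isExp-exp[i x ] ⟩
      ∣ x ∣ * ∣ x ∣     ≈⟨ *-cong ∣x∣≈x′ ∣x∣≈x′ ⟩
      x * x             <⟨ *-monoʳ-< 0<x x<1 ⟩
      x * 1#            ≈⟨ *-identityʳ x ⟩
      x                 ∎)
    (solve 2 (λ s x → x :- (:- (s :- x)) := s :- :0) refl (sin x) x)
    where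
    ∣x∣≈x′ = ∣x∣≈x (<⇒≤ 0<x)

  below : ∀ {x} → 0# < x → ∃[ y ] 0# < y × y < x
  below {x} 0<x = let y , 0<y , y+y≈x = halve 0<x in
    y , 0<y , <-respʳ-≈ y+y≈x (<-respˡ-≈ (+-identityˡ y) (+-monoˡ-< y 0<y))

  module _ {π} (isPi : IsPi π) where

    sin-pos : ∀ {x} → 0# < x → x < π → 0# < sin x
    sin-pos {x} 0<x x<π = ≰⇒> sin≰0
      where
      zero-free : ∀ y → 0# < y → y < π → ¬ (sin y ≈ 0#)
      zero-free y 0<y y<π sin≈0 = proj₂ (proj₂ isPi) y 0<y y<π (exp[i y ] , isExp-exp[i y ] , sin≈0)
      sin≰0 : ¬ (sin x ≤ 0#)
      sin≰0 (inj₂ sin≈0) = zero-free x 0<x x<π sin≈0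
      sin≰0 (inj₁ sin<0) =
        -- A point a below both 1 and x has sin a > 0, so a negative value at x would force a zero
        -- in (a, x), below π.
        let m , 0<m , m≤1 , m≤x = common-lower-bound 0<1 0<x
            a , 0<a , a<m = below 0<m
            y , a<y , y<x , sin≈0 = intermediate-zero sin-locallyLipschitz
              (<-≤-trans a<m m≤x) (sin-pos-near-0 0<a (<-≤-trans a<m m≤1)) sin<0
        in zero-free y (<-trans 0<a a<y) (<-trans y<x x<π) sin≈0

    module _ {φ e} (exp-φ : IsExp (i· φ) e) where

      -- De Moivre's formula, started at the first power, where it is the hypothesis on e.
      isExp-^ : ∀ k → IsExp (i· (fromℕᴿ (suc k) * φ)) (e ^ᶜ suc k)
      isExp-^ zero    = isExp-cong (refl , solve 1 (λ x → x := (:1 :+ :0) :* x) refl φ)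
        (lim-congʳ (proj₁ e≈e*1) (proj₁ exp-φ) , lim-congʳ (proj₂ e≈e*1) (proj₂ exp-φ))
        where
        e≈e*1 : e ≈ᶜ e *ᶜ 1ᶜ
        e≈e*1 = ℂR.sym (ℂR.*-identityʳ e)
      isExp-^ (suc k) = isExp-cong
        (+-identityˡ 0# , solve 2 (λ κ x → x :+ κ :* x := (:1 :+ κ) :* x) refl (fromℕᴿ (suc k)) φ)
        (isExp-+ (i· φ) (i· (fromℕᴿ (suc k) * φ)) exp-φ (isExp-^ k))

      im-^-pos : ∀ {n} → 0# < φ → fromℕᴿ n * φ < π → ∀ {k} → 1 ℕ.≤ k → k ℕ.≤ n → 0# < im (e ^ᶜ k)
      im-^-pos {n} 0<φ nφ<π {suc k} _ k<n = <-respʳ-≈ (sin-unique (isExp-^ k))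
        (sin-pos (*-pos (fromℕᴿ-pos k) 0<φ)
          (≤-<-trans (*-mono-≤ (<⇒≤ 0<φ) (fromℕᴿ-mono k<n) ≤-refl (fromℕᴿ-nonneg n)) nφ<π))

  -- At |φ| = 0 the quadratic remainder bound is 0 and forces equality, so the series need not be
  -- evaluated.
  isExp-0 : ∀ {φ e} → φ ≈ 0# → IsExp (i· φ) e → e ≈ᶜ 1ᶜ
  isExp-0 {φ} {e} φ≈0 exp-φ =
    x-y≈0 (re e) 1# (≤-trans (cos-near-0 ∣φ∣≤1 exp-φ) φ²≤0) ,
    trans (x-y≈0 (im e) φ (≤-trans (sin-near-0 ∣φ∣≤1 exp-φ) φ²≤0)) φ≈0
    where
    ∣φ∣≈0 = trans (∣∣-cong φ≈0) (∣x∣≈x ≤-refl)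
    ∣φ∣≤1 = ≤-trans (≈⇒≤ ∣φ∣≈0) 0≤1
    φ²≤0 : ∣ φ ∣ * ∣ φ ∣ ≤ 0#
    φ²≤0 = ≈⇒≤ (trans (*-congʳ ∣φ∣≈0) (zeroˡ _))
    x-y≈0 : ∀ x y → ∣ x - y ∣ ≤ 0# → x ≈ y
    x-y≈0 x y p = ≤-antisym
      (≤-transfer (≤-trans (x≤∣x∣ (x - y)) p) (solve 2 (λ x y → :0 :- (x :- y) := y :- x) refl x y))
      (≤-transfer (≤-trans (-x≤∣x∣ (x - y)) p) (solve 2 (λ x y → :0 :- (:- (x :- y)) := x :- y) refl x y))

-- Linear functionals that are nonnegative on the powers of a point

module SectorPowers {c ℓ₁ ℓ₂} (R : CompleteOrderedField c ℓ₁ ℓ₂) where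

  open RealComplex R
  open OrderedField R
  open ComplexExponential R
  open Exponential R
  open Sine R
  open RingSolver commutativeRing
  open ≤-Reasoning

  -- Every ℝ-linear functional on ℂ is of this form.
  infix 8 ⟨_,_⟩
  ⟨_,_⟩ : ℂ → ℂ → ℝ
  ⟨ u , x ⟩ = re (u *ᶜ x)

  ⟨⟩-congʳ : ∀ u {x y} → x ≈ᶜ y → ⟨ u , x ⟩ ≈ ⟨ u , y ⟩
  ⟨⟩-congʳ u x≈y = proj₁ (ℂR.*-congˡ {u} x≈y)

  ⟨⟩-scale : ∀ u b x → ⟨ u , ofReal b *ᶜ x ⟩ ≈ b * ⟨ u , x ⟩
  ⟨⟩-scale (p , q) b (x , y) = solve 5 (λ p q b x y →
    p :* (b :* x :- :0 :* y) :- q :* (b :* y :+ :0 :* x) := b :* (p :* x :- q :* y)) refl p q b x y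

  ⟨⟩-assoc : ∀ u z x → ⟨ u *ᶜ z , x ⟩ ≈ ⟨ u , z *ᶜ x ⟩
  ⟨⟩-assoc u z x = proj₁ (ℂR.*-assoc u z x)

  ⟨⟩-+ : ∀ u x y → ⟨ u , x +ᶜ y ⟩ ≈ ⟨ u , x ⟩ + ⟨ u , y ⟩
  ⟨⟩-+ u x y = proj₁ (ℂR.distribˡ u x y)

  ⟨⟩-sum : ∀ u {n} (t : Fin n → ℂ) (s : Fin n → ℝ) → (∀ j → ⟨ u , t j ⟩ ≈ s j) →
           ⟨ u , sumᶜ t ⟩ ≈ foldr _+_ 0# (tabulate s)
  ⟨⟩-sum u {zero}  t s t≈s = proj₁ (ℂR.zeroʳ u)
  ⟨⟩-sum u {suc n} t s t≈s = trans (⟨⟩-+ u (t Fin.zero) _) (+-cong (t≈s Fin.zero) (⟨⟩-sum u (t ∘ Fin.suc) (s ∘ Fin.suc) (t≈s ∘ Fin.suc)))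

  NonnegOnPowers : ℂ → ℕ → ℂ → Set _
  NonnegOnPowers w d u = ∀ k → k ℕ.≤ d → 0# ≤ ⟨ u , w ^ᶜ k ⟩

  module _ {v w z} (0≤v : 0# ≤ v) (z≈v+w : z ≈ᶜ ofReal v +ᶜ w) where

    ⟨u*z,⟩ : ∀ u x → ⟨ u *ᶜ z , x ⟩ ≈ v * ⟨ u , x ⟩ + ⟨ u , w *ᶜ x ⟩
    ⟨u*z,⟩ u x = begin-equality
      ⟨ u *ᶜ z , x ⟩                            ≈⟨ ⟨⟩-assoc u z x ⟩
      ⟨ u , z *ᶜ x ⟩                            ≈⟨ ⟨⟩-congʳ u (ℂR.trans (ℂR.*-congʳ z≈v+w) (ℂR.distribʳ x (ofReal v) w)) ⟩
      ⟨ u , ofReal v *ᶜ x +ᶜ w *ᶜ x ⟩           ≈⟨ ⟨⟩-+ u (ofReal v *ᶜ x) (w *ᶜ x) ⟩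
      ⟨ u , ofReal v *ᶜ x ⟩ + ⟨ u , w *ᶜ x ⟩    ≈⟨ +-congʳ (⟨⟩-scale u v x) ⟩
      v * ⟨ u , x ⟩ + ⟨ u , w *ᶜ x ⟩            ∎

    -- Moving a factor z from the power into u costs one degree of known positivity, which is just
    -- the degree that the power loses.
    nonneg-shift : ∀ {d u} → NonnegOnPowers w (suc d) u → NonnegOnPowers w d (u *ᶜ z)
    nonneg-shift {u = u} nn k k≤d = ≤-respʳ (sym (⟨u*z,⟩ u (w ^ᶜ k)))
      (+-nonneg (*-nonneg 0≤v (nn k (ℕ.m≤n⇒m≤1+n k≤d))) (nn (suc k) (ℕ.s≤s k≤d)))

    nonneg-power : ∀ d {u} → NonnegOnPowers w d u → 0# ≤ ⟨ u , z ^ᶜ d ⟩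
    nonneg-power zero    nn = nn 0 ℕ.z≤n
    nonneg-power (suc d) {u} nn = ≤-respʳ (⟨⟩-assoc u z (z ^ᶜ d)) (nonneg-power d (nonneg-shift nn))

    -- For k ≥ 1, (v+w)^(j+k) - v^k (v+w)^j - w^(j+k) has nonnegative coefficients;
    -- instead of expanding it, each inductive step replaces u by u z.
    power-bound : ∀ j m {u} → NonnegOnPowers w (j ℕ.+ suc m) u →
      v ^ suc m * ⟨ u , z ^ᶜ j ⟩ + ⟨ u , w ^ᶜ (j ℕ.+ suc m) ⟩ ≤ ⟨ u , z ^ᶜ (j ℕ.+ suc m) ⟩
    power-bound zero zero {u} nn = ≈⇒≤ $ begin-equality
      v * 1# * ⟨ u , 1ᶜ ⟩ + ⟨ u , w *ᶜ 1ᶜ ⟩   ≈⟨ +-congʳ (*-congʳ (*-identityʳ v)) ⟩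
      v * ⟨ u , 1ᶜ ⟩ + ⟨ u , w *ᶜ 1ᶜ ⟩        ≈⟨ ⟨u*z,⟩ u 1ᶜ ⟨
      ⟨ u *ᶜ z , 1ᶜ ⟩                         ≈⟨ ⟨⟩-assoc u z 1ᶜ ⟩
      ⟨ u , z *ᶜ 1ᶜ ⟩                         ∎
    power-bound zero (suc m) {u} nn = begin
      v * v ^ suc m * x₀ + y₁
        -- The bound for `u *ᶜ z` exceeds what is wanted by `v ^ suc m * x₁ + v * y₀`, both terms of
        -- which are nonnegative.
        ≤⟨ ≤-transfer (+-nonneg (*-nonneg (^-nonneg 0≤v (suc m)) (nn 1 (ℕ.s≤s ℕ.z≤n)))
                                (*-nonneg 0≤v (nn (suc m) (ℕ.n≤1+n (suc m)))))
             (solve 6 (λ v p x₀ x₁ y₀ y₁ → p :* x₁ :+ v :* y₀ :- :0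
                := p :* (v :* x₀ :+ x₁) :+ (v :* y₀ :+ y₁) :- (v :* p :* x₀ :+ y₁)) refl v (v ^ suc m) x₀ x₁ y₀ y₁) ⟩
      v ^ suc m * (v * x₀ + x₁) + (v * y₀ + y₁)
        ≈⟨ +-cong (*-congˡ (⟨u*z,⟩ u 1ᶜ)) (⟨u*z,⟩ u (w ^ᶜ suc m)) ⟨
      v ^ suc m * ⟨ u *ᶜ z , 1ᶜ ⟩ + ⟨ u *ᶜ z , w ^ᶜ suc m ⟩
        ≤⟨ power-bound 0 m (nonneg-shift nn) ⟩
      ⟨ u *ᶜ z , z ^ᶜ suc m ⟩
        ≈⟨ ⟨⟩-assoc u z (z ^ᶜ suc m) ⟩
      ⟨ u , z ^ᶜ suc (suc m) ⟩ ∎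
      where
      x₀ = ⟨ u , 1ᶜ ⟩
      x₁ = ⟨ u , w *ᶜ 1ᶜ ⟩
      y₀ = ⟨ u , w ^ᶜ suc m ⟩
      y₁ = ⟨ u , w ^ᶜ suc (suc m) ⟩
    power-bound (suc j) m {u} nn = begin
      v ^ suc m * ⟨ u , z *ᶜ z ^ᶜ j ⟩ + y₁
        ≤⟨ ≤-transfer (*-nonneg 0≤v (nn (j ℕ.+ suc m) (ℕ.n≤1+n _)))
             (solve 4 (λ v q y₀ y₁ → v :* y₀ :- :0 := q :+ (v :* y₀ :+ y₁) :- (q :+ y₁)) refl v _ y₀ y₁) ⟩
      v ^ suc m * ⟨ u , z *ᶜ z ^ᶜ j ⟩ + (v * y₀ + y₁)
        ≈⟨ +-cong (*-congˡ (⟨⟩-assoc u z (z ^ᶜ j))) (⟨u*z,⟩ u (w ^ᶜ (j ℕ.+ suc m))) ⟨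
      v ^ suc m * ⟨ u *ᶜ z , z ^ᶜ j ⟩ + ⟨ u *ᶜ z , w ^ᶜ (j ℕ.+ suc m) ⟩
        ≤⟨ power-bound j m (nonneg-shift nn) ⟩
      ⟨ u *ᶜ z , z ^ᶜ (j ℕ.+ suc m) ⟩
        ≈⟨ ⟨⟩-assoc u z (z ^ᶜ (j ℕ.+ suc m)) ⟩
      ⟨ u , z ^ᶜ (suc j ℕ.+ suc m) ⟩ ∎
      where
      y₀ = ⟨ u , w ^ᶜ (j ℕ.+ suc m) ⟩
      y₁ = ⟨ u , w ^ᶜ (suc j ℕ.+ suc m) ⟩

  ^-distrib-* : ∀ x y k → (x *ᶜ y) ^ᶜ k ≈ᶜ x ^ᶜ k *ᶜ y ^ᶜ k
  ^-distrib-* x y zero    = ℂR.sym (ℂR.*-identityˡ 1ᶜ)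
  ^-distrib-* x y (suc k) = ℂR.trans (ℂR.*-congˡ (^-distrib-* x y k))
    (ℂS.solve 4 (λ x y p q → x ℂS.:* y ℂS.:* (p ℂS.:* q) ℂS.:= x ℂS.:* p ℂS.:* (y ℂS.:* q)) ℂR.refl x y (x ^ᶜ k) (y ^ᶜ k))

  ofReal-^ : ∀ x k → ofReal x ^ᶜ k ≈ᶜ ofReal (x ^ k)
  ofReal-^ x zero    = ℂR.refl
  ofReal-^ x (suc k) = ℂR.trans (ℂR.*-congˡ (ofReal-^ x k)) (ℂR.trans (ofReal-* x _) (refl , zeroʳ x))

  ⟨⟩-scaled-power : ∀ u ρ e k → ⟨ u , (ofReal ρ *ᶜ e) ^ᶜ k ⟩ ≈ ρ ^ k * ⟨ u , e ^ᶜ k ⟩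
  ⟨⟩-scaled-power u ρ e k = trans
    (⟨⟩-congʳ u (ℂR.trans (^-distrib-* (ofReal ρ) e k) (ℂR.*-congʳ (ofReal-^ ρ k))))
    (⟨⟩-scale u (ρ ^ k) (e ^ᶜ k))

  -- A closed half-plane through 0 that contains 1, w, ..., wⁿ and has wⁿ in its interior.
  Supporting : ℂ → ℕ → ℂ → Set _
  Supporting w n u = NonnegOnPowers w n u × 0# < ⟨ u , w ^ᶜ n ⟩

  -i : ℂ
  -i = 0# , - 1#

  ⟨-i,⟩ : ∀ x → ⟨ -i , x ⟩ ≈ im x
  ⟨-i,⟩ (x , y) = solve 2 (λ x y → :0 :* x :- (:- :1) :* y := y) refl x y

  ⟨i,⟩ : ∀ x → ⟨ conj -i , x ⟩ ≈ im (conj x)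
  ⟨i,⟩ (x , y) = solve 2 (λ x y → :0 :* x :- (:- (:- :1)) :* y := :- y) refl x y

  module _ {π} (isPi : IsPi π) where

    supporting-unit : ∀ {φ e n} → 1 ℕ.≤ n → fromℕᴿ n * ∣ φ ∣ < π → IsExp (i· φ) e → ∃[ u ] Supporting e n u
    supporting-unit {φ} {e} {n} 1≤n n∣φ∣<π exp-φ = by-sign (compare 0# φ)
      where
      nx<π : ∀ {x} → x ≤ ∣ φ ∣ → fromℕᴿ n * x < π
      nx<π x≤∣φ∣ = ≤-<-trans (*-monoʳ-≤ (fromℕᴿ-nonneg n) x≤∣φ∣) n∣φ∣<π

      by-sign : _ → ∃[ u ] Supporting e n u
      by-sign (tri< 0<φ _ _) = -i , nonneg , <-respʳ-≈ (sym (⟨-i,⟩ (e ^ᶜ n))) (im-pos 1≤n ℕ.≤-refl)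
        where
        im-pos : ∀ {k} → 1 ℕ.≤ k → k ℕ.≤ n → 0# < im (e ^ᶜ k)
        im-pos = im-^-pos isPi exp-φ {n} 0<φ (nx<π (x≤∣x∣ φ))
        nonneg : NonnegOnPowers e n -i
        -- The imaginary part of 1 is 0: at k = 0 only the weak inequality holds.
        nonneg zero    _   = ≈⇒≤ (sym (⟨-i,⟩ 1ᶜ))
        nonneg (suc k) k<n = ≤-respʳ (sym (⟨-i,⟩ (e ^ᶜ suc k))) (<⇒≤ (im-pos (ℕ.s≤s ℕ.z≤n) k<n))
      -- The conjugate of e is the exponential at -iφ, and -im (eᵏ) is the imaginary part of its
      -- k-th power, so the positivity of sin on (0, π) applies to -φ.
      by-sign (tri> _ _ φ<0) = conj -i , nonneg ,
        <-respʳ-≈ (trans (proj₂ (ℂR.sym (conj-^ e n))) (sym (⟨i,⟩ (e ^ᶜ n)))) (im-pos 1≤n ℕ.≤-refl)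
        where
        im-pos : ∀ {k} → 1 ℕ.≤ k → k ℕ.≤ n → 0# < im (conj e ^ᶜ k)
        im-pos = im-^-pos isPi (isExp-conj exp-φ) {n}
          (<-transfer φ<0 (solve 1 (λ x → :0 :- x := :- x :- :0) refl φ)) (nx<π (-x≤∣x∣ φ))
        nonneg : NonnegOnPowers e n (conj -i)
        nonneg zero    _   = ≈⇒≤ (sym (trans (⟨i,⟩ 1ᶜ) (solve 0 (:- :0 := :0) refl)))
        nonneg (suc k) k<n = ≤-respʳ (trans (proj₂ (ℂR.sym (conj-^ e (suc k)))) (sym (⟨i,⟩ (e ^ᶜ suc k))))
          (<⇒≤ (im-pos (ℕ.s≤s ℕ.z≤n) k<n))
      by-sign (tri≈ _ 0≈φ _) = 1ᶜ , (λ k _ → <⇒≤ (⟨1,e^k⟩>0 k)) , ⟨1,e^k⟩>0 n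
        where
        e^k≈1 : ∀ k → e ^ᶜ k ≈ᶜ 1ᶜ
        e^k≈1 zero    = ℂR.refl
        e^k≈1 (suc k) = ℂR.trans (ℂR.*-cong (isExp-0 (sym 0≈φ) exp-φ) (e^k≈1 k)) (ℂR.*-identityˡ 1ᶜ)
        ⟨1,e^k⟩>0 : ∀ k → 0# < ⟨ 1ᶜ , e ^ᶜ k ⟩
        ⟨1,e^k⟩>0 k = <-respʳ-≈ (sym (trans (proj₁ (ℂR.*-identityˡ (e ^ᶜ k))) (proj₁ (e^k≈1 k)))) 0<1

  supporting-scale : ∀ {ρ e n u} → 0# < ρ → Supporting e n u → Supporting (ofReal ρ *ᶜ e) n u
  supporting-scale {ρ} {e} {n} {u} 0<ρ (nonneg , pos) =
    (λ k k≤n → ≤-respʳ (sym (⟨⟩-scaled-power u ρ e k)) (*-nonneg (<⇒≤ (^-pos 0<ρ k)) (nonneg k k≤n))) ,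
    <-respʳ-≈ (sym (⟨⟩-scaled-power u ρ e n)) (*-pos (^-pos 0<ρ n) pos)

-- Lower bounds for sums of coefficients with nonnegative weights

module WeightedSums {c ℓ₁ ℓ₂} (R : CompleteOrderedField c ℓ₁ ℓ₂) where

  open RealComplex R
  open OrderedField R
  open RingSolver commutativeRing
  open ≤-Reasoning

  module _ {n} (a q : Vector ℝ (suc n)) (0≤q : ∀ j → 0# ≤ q j) where

    private
      neg? = λ j → a j <? 0#
      aq : Vector ℝ (suc n)
      aq j = a j * q j

    module _ {Q : ℝ} where

      BoundedBy : List (Fin (suc n)) → Set _
      BoundedBy = All (λ j → a j < 0# → q j ≤ Q)

      -- A negative coefficient only lowers the sum if its weight is raised to Q; any other term is
      -- nonnegative and is dropped.
      prepend-bound : ∀ {j js s} → (a j < 0# → q j ≤ Q) →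
        Q * sumOver (filter neg? js) a ≤ s → Q * sumOver (filter neg? (j ∷ js)) a ≤ a j * q j + s
      prepend-bound {j} {js} {s} q≤Q IH with neg? j
      ... | yes aj<0 = begin
        Q * (a j + sumOver (filter neg? js) a)          ≈⟨ distribˡ _ _ _ ⟩
        Q * a j + Q * sumOver (filter neg? js) a        ≤⟨ +-mono-≤
          (≤-transfer (*-nonneg (≤⇒0≤- (<⇒≤ aj<0)) (≤⇒0≤- (q≤Q aj<0)))
            (solve 3 (λ a q Q → (:0 :- a) :* (Q :- q) :- :0 := a :* q :- Q :* a) refl (a j) (q j) Q)) IH ⟩
        a j * q j + s                                   ∎
      ... | no aj≮0 = begin
        Q * sumOver (filter neg? js) a                  ≈⟨ +-identityˡ _ ⟨
        0# + Q * sumOver (filter neg? js) a             ≤⟨ +-mono-≤ (*-nonneg (≮⇒≥ aj≮0) (0≤q j)) IH ⟩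
        a j * q j + s                                   ∎

      weighted-sum-bound : ∀ {js} → BoundedBy js →
        Q * sumOver (filter neg? js) a ≤ sumOver js aq
      weighted-sum-bound []           = ≈⇒≤ (zeroʳ Q)
      weighted-sum-bound {j ∷ js} (q≤Q ∷ bounded) = prepend-bound {j} {js} q≤Q (weighted-sum-bound bounded)

      -- Keeps one positive term instead of dropping it: the leading term has to pay for all the
      -- negative ones.
      weighted-sum-bound-∈ : ∀ {p js} → 0# < a p → p ∈ js → BoundedBy js →
        a p * q p + Q * sumOver (filter neg? js) a ≤ sumOver js aq
      weighted-sum-bound-∈ {p} {_ ∷ js} 0<ap (here ≡.refl) (_ ∷ bounded)
        rewrite filter-reject neg? {p} {js} (asym 0<ap) = +-monoʳ-≤ _ (weighted-sum-bound bounded)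
      weighted-sum-bound-∈ {p} {j ∷ js} 0<ap (there p∈js) (q≤Q ∷ bounded) =
        ≤-transfer (prepend-bound {j} {js} q≤Q (0≤-⇒≤ (≤-respʳ
            (solve 3 (λ s x y → s :- (x :+ y) := s :- x :- y) refl (sumOver js aq) (a p * q p) (Q * sumOver (filter neg? js) a))
            (≤⇒0≤- (weighted-sum-bound-∈ 0<ap p∈js bounded)))))
          (solve 4 (λ x s t y → x :+ (s :- t) :- y := x :+ s :- (t :+ y)) refl
            (a j * q j) (sumOver js aq) (a p * q p) (Q * sumOver (filter neg? (j ∷ js)) a))

    -- Q is the running maximum of the weights at negative coefficients, started at 0. Being 0 or
    -- one of these weights, it inherits the bound that each of them satisfies.
    common-bound : ∀ {A T} → 0# ≤ T → (∀ j → a j < 0# → A * q j ≤ T) → ∀ js →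
                   ∃[ Q ] 0# ≤ Q × A * Q ≤ T × BoundedBy {Q} js
    common-bound 0≤T Aq≤T []       = 0# , ≤-refl , ≤-respˡ (sym (zeroʳ _)) 0≤T , []
    common-bound 0≤T Aq≤T (j ∷ js) with common-bound 0≤T Aq≤T js | neg? j
    ... | Q , 0≤Q , AQ≤T , bounded | no aj≮0 = Q , 0≤Q , AQ≤T , (⊥-elim ∘ aj≮0) ∷ bounded
    ... | Q , 0≤Q , AQ≤T , bounded | yes aj<0 with ≤-total (q j) Q
    ...   | inj₁ q≤Q = Q , 0≤Q , AQ≤T , (λ _ → q≤Q) ∷ bounded
    ...   | inj₂ Q≤q = q j , 0≤q j , Aq≤T j aj<0 , (λ _ → ≤-refl) ∷ All.map (λ b aj<0 → ≤-trans (b aj<0) Q≤q) bounded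

    -- With S the sum of the negative coefficients, the whole sum is at least aₚ qₚ + Q S ≥ aₚ qₚ -
    -- A Q ≥ aₚ qₚ - T > 0.
    weighted-sum-pos : ∀ {A T p} → - sumOver (negativeIndices a) a ≤ A → 0# ≤ T → 0# < a p → T < a p * q p →
      (∀ j → a j < 0# → A * q j ≤ T) → 0# < sumOver (allFin (suc n)) aq
    weighted-sum-pos {A} {T} {p} -S≤A 0≤T 0<ap T<aq Aq≤T =
      let Q , 0≤Q , AQ≤T , bounded = common-bound 0≤T Aq≤T (allFin (suc n)) in
      <-≤-trans
        (<-transfer (≤-<-trans (≤-trans (*-monoʳ-≤ 0≤Q -S≤A) (≤-respˡ (*-comm A Q) AQ≤T)) T<aq)
          (solve 3 (λ t Q s → t :- Q :* (:- s) := t :+ Q :* s :- :0) refl (a p * q p) Q (sumOver (negativeIndices a) a)))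
        (weighted-sum-bound-∈ 0<ap (∈-allFin p) bounded)

-- Values of the polynomial at points of the sector

module SectorZeros {c ℓ₁ ℓ₂} (R : CompleteOrderedField c ℓ₁ ℓ₂) where

  open RealComplex R
  open OrderedField R
  open ComplexExponential R
  open SectorPowers R
  open WeightedSums R
  open RingSolver commutativeRing
  open ≤-Reasoning

  ⟨⟩-eval : ∀ u {n} (a : Vector ℝ (suc n)) z →
    ⟨ u , eval a z ⟩ ≈ sumOver (allFin (suc n)) (λ j → a j * ⟨ u , z ^ᶜ toℕ j ⟩)
  ⟨⟩-eval u a z = trans
    (⟨⟩-sum u (λ j → ofReal (a j) *ᶜ z ^ᶜ toℕ j) aq (λ j → ⟨⟩-scale u (a j) (z ^ᶜ toℕ j)))
    (reflexive (≡.cong (foldr _+_ 0#) (≡.sym (map-tabulate id aq))))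
    where
    aq : _ → ℝ
    aq j = a j * ⟨ u , z ^ᶜ toℕ j ⟩

  module _ {n} (a : Vector ℝ (suc n)) (0<aₙ : 0# < a (fromℕ n)) where

    negative⇒<n : ∀ {j} → a j < 0# → toℕ j ℕ.< n
    negative⇒<n {j} aj<0 = ℕ.≤∧≢⇒< (Fin.toℕ≤pred[n] j) λ j≡n →
      asym 0<aₙ (≡.subst (λ i → a i < 0#) (Fin.toℕ-injective (≡.trans j≡n (≡.sym (Fin.toℕ-fromℕ n)))) aj<0)

    module _ {A v w z u} (1≤n : 1 ℕ.≤ n) (0≤v : 0# ≤ v) (z≈v+w : z ≈ᶜ ofReal v +ᶜ w)
             (supporting : Supporting w n u)
             (-S≤A : - sumOver (negativeIndices a) a ≤ A)
             (A≤aₙvᵐ : ∀ j → a j < 0# → A ≤ a (fromℕ n) * v ^ (n ∸ toℕ j)) where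

      private
        nonneg = proj₁ supporting
        aₙ = a (fromℕ n)
        qₙ = ⟨ u , z ^ᶜ n ⟩
        pₙ = ⟨ u , w ^ᶜ n ⟩
        q : Vector ℝ (suc n)
        q j = ⟨ u , z ^ᶜ toℕ j ⟩

      0≤q : ∀ j → 0# ≤ q j
      0≤q j = nonneg-power 0≤v z≈v+w (toℕ j) (λ k k≤j → nonneg k (ℕ.≤-trans k≤j (Fin.toℕ≤pred[n] j)))

      power-bound-∸ : ∀ {j} → j ℕ.< n → v ^ (n ∸ j) * ⟨ u , z ^ᶜ j ⟩ + pₙ ≤ qₙ
      -- `power-bound` writes n as j + (1 + k) with k = n - j - 1. The inner transport turns the
      -- exponent 1 + k into a difference, the outer one turns j + (1 + k) into n.
      power-bound-∸ {j} j<n = ≡.subst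
        (λ N → NonnegOnPowers w N u → v ^ (N ∸ j) * ⟨ u , z ^ᶜ j ⟩ + ⟨ u , w ^ᶜ N ⟩ ≤ ⟨ u , z ^ᶜ N ⟩)
        (≡.trans (ℕ.+-suc j k) (ℕ.m+[n∸m]≡n j<n))
        (≡.subst (λ m → NonnegOnPowers w (j ℕ.+ suc k) u →
                   v ^ m * ⟨ u , z ^ᶜ j ⟩ + ⟨ u , w ^ᶜ (j ℕ.+ suc k) ⟩ ≤ ⟨ u , z ^ᶜ (j ℕ.+ suc k) ⟩)
          (≡.sym (ℕ.m+n∸m≡n j (suc k))) (power-bound 0≤v z≈v+w j k))
        nonneg
        where k = n ∸ suc j

      ⟨eval⟩>0 : 0# < ⟨ u , eval a z ⟩
      ⟨eval⟩>0 = <-respʳ-≈ (sym (⟨⟩-eval u a z))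
        (weighted-sum-pos a q 0≤q {p = fromℕ n} -S≤A
          (*-nonneg (<⇒≤ 0<aₙ) (≤⇒0≤- pₙ≤qₙ)) 0<aₙ T<aₙqₙ Aq≤T)
        where
        -- The budget for the negative terms: it covers `A * q j` for each negative index, yet stays
        -- below the leading term by `aₙ * pₙ`, which is positive.
        T = aₙ * (qₙ - pₙ)
        -- The power bound at j = 0, available because n ≥ 1. It gives 0 ≤ `T` even if no
        -- coefficient is negative.
        pₙ≤qₙ : pₙ ≤ qₙ
        pₙ≤qₙ = begin
          pₙ                        ≈⟨ +-identityˡ pₙ ⟨
          0# + pₙ                   ≤⟨ +-monoˡ-≤ pₙ (*-nonneg (^-nonneg 0≤v n) (nonneg 0 ℕ.z≤n)) ⟩
          v ^ n * ⟨ u , 1ᶜ ⟩ + pₙ   ≤⟨ power-bound-∸ 1≤n ⟩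
          qₙ                        ∎
        T<aₙqₙ : T < aₙ * q (fromℕ n)
        T<aₙqₙ = ≡.subst (λ m → T < aₙ * ⟨ u , z ^ᶜ m ⟩) (≡.sym (Fin.toℕ-fromℕ n))
          (*-monoʳ-< 0<aₙ (<-transfer (proj₂ supporting)
            (solve 2 (λ p q → p :- :0 := q :- (q :- p)) refl pₙ qₙ)))
        Aq≤T : ∀ j → a j < 0# → A * q j ≤ T
        Aq≤T j aj<0 = begin
          A * q j                            ≤⟨ *-mono-≤ (0≤q j) (A≤aₙvᵐ j aj<0) ≤-refl (*-nonneg (<⇒≤ 0<aₙ) (^-nonneg 0≤v m)) ⟩
          aₙ * v ^ m * q j                   ≈⟨ *-assoc aₙ (v ^ m) (q j) ⟩
          aₙ * (v ^ m * q j)                 ≤⟨ *-monoʳ-≤ (<⇒≤ 0<aₙ) (≤-transfer (power-bound-∸ (negative⇒<n aj<0))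
                                                 (solve 3 (λ x p q → q :- (x :+ p) := q :- p :- x) refl (v ^ m * q j) pₙ qₙ)) ⟩
          aₙ * (qₙ - pₙ)                     ∎
          where m = n ∸ toℕ j

  -- The default value 0 takes part in the maximum, so v ≥ 0 holds also for an empty list; this sign
  -- is what makes the terms dropped in `power-bound` nonnegative.
  maxOver≥0 : ∀ {n} (r : Vector ℝ (suc n)) js → 0# ≤ maxOver js r
  maxOver≥0 r js = Extrema.f[⊥]≤f[argmax] totalOrder {f = id} 0# (map r js)

  root≤maxOver : ∀ {n} (a r : Vector ℝ (suc n)) {j} → a j < 0# → r j ≤ maxOver (negativeIndices a) r
  root≤maxOver a r {j} aj<0 = All.lookup
    (Extrema.f[xs]≤f[argmax] totalOrder {f = id} 0# (map r (negativeIndices a)))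
    (∈-map⁺ r (∈-filter⁺ (λ j → a j <? 0#) (∈-allFin j) aj<0))

theorem2p5 : ∀ {c ℓ₁ ℓ₂} (R : CompleteOrderedField c ℓ₁ ℓ₂) → let open RealComplex R in
    (π : ℝ) → IsPi π →
    (n : ℕ) → 1 ℕ.≤ n →
    (a : Vector ℝ (suc n)) → 0# < a (fromℕ n) →
    let js = negativeIndices a in
    (r : Vector ℝ (suc n)) →
    (∀ j → a j < 0# → IsRoot (n ∸ toℕ j) (∣ sumOver js a ∣ / a (fromℕ n)) (r j)) →
    let v = maxOver js r in
    (z : ℂ) → Sector v (π / fromℕᴿ n) z → ¬ (eval a z ≈ᶜ 0ᶜ)
theorem2p5 R π isPi n@(suc n-1) 1≤n a 0<aₙ r isRoot z (ρ , φ , e , 0<ρ , ∣φ∣<π/n , exp-φ , z≈v+ρe) fz≈0 =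
  let u , supporting-e = supporting-unit isPi 1≤n n∣φ∣<π exp-φ
      0<⟨fz⟩ = ⟨eval⟩>0 a 0<aₙ {u = u} 1≤n (maxOver≥0 r js) z≈v+ρe
        (supporting-scale {n = n} {u = u} 0<ρ supporting-e) (-x≤∣x∣ (sumOver js a)) A≤aₙvᵐ
  in irrefl refl (<-respʳ-≈ (trans (⟨⟩-congʳ u fz≈0) (proj₁ (ℂR.zeroʳ u))) 0<⟨fz⟩)
  where
  open RealComplex R
  open OrderedField R
  open ComplexExponential R
  open SectorPowers R
  open SectorZeros R
  open ≤-Reasoning
  js = negativeIndices a
  A = ∣ sumOver js a ∣

  n∣φ∣<π : fromℕᴿ n * ∣ φ ∣ < π
  n∣φ∣<π = <-respʳ-≈ (x*[y/x]≈y (fromℕᴿ-pos n-1) π) (*-monoʳ-< (fromℕᴿ-pos n-1) ∣φ∣<π/n)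

  A≤aₙvᵐ : ∀ j → a j < 0# → A ≤ a (fromℕ n) * maxOver js r ^ (n ∸ toℕ j)
  -- `r j` solves aₙ x^(n-j) = A, and v is at least `r j`.
  A≤aₙvᵐ j aj<0 = begin
    A                                                ≈⟨ x*[y/x]≈y 0<aₙ A ⟨
    a (fromℕ n) * (A / a (fromℕ n))                  ≈⟨ *-congˡ (proj₂ (isRoot j aj<0)) ⟨
    a (fromℕ n) * r j ^ (n ∸ toℕ j)
      ≤⟨ *-monoʳ-≤ (<⇒≤ 0<aₙ) (^-mono-≤ (proj₁ (isRoot j aj<0)) (root≤maxOver a r aj<0) (n ∸ toℕ j)) ⟩
    a (fromℕ n) * maxOver js r ^ (n ∸ toℕ j)         ∎
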